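{- Let $k$ be a positive integer and $i\in\{5,7,11\}$. Let $p$ be a prime with $p\equiv i\pmod{12}$, and let $\delta$ be a non-negative integer such that $p$ divides $12\delta+i$. Then for every non-negative integer $n$, \[ \sigma mex\left(p^{k+1}n+p\delta+\frac{pi-1}{12}\right)\equiv f(p)\,\sigma mex\left(p^{k-1}n+\frac{12\delta+i-p}{12p}\right)\pmod 4, \] where $f(p)=-1$ if $p\equiv 5\pmod{12}$ and $f(p)=1$ if $p\equiv 7,11\pmod{12}$.
   Context: For a partition $\pi$ of a positive integer $n$, $mex(\pi)$ is the smallest positive integer that is not a part of $\pi$. For a positive integer $n$, $\sigma mex(n)=\sum_{\pi} mex(\pi)$, summed over all partitions $\pi$ of $n$, and $\sigma mex(0)=1$. Equivalently, $\sum_{n\geq 0}\sigma mex(n)q^n=(-q;q)_\infty^2$, where $(a;q)_\infty=\prod_{m\geq 1}(1-aq^{m-1})$. -}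

module Defs where

open import Data.Nat using (ℕ; zero; suc; _+_; _*_; _∸_; _≤?_)
open import Data.Nat.Properties using (_≟_)
open import Data.List using (List; []; _∷_; [_]; _++_; map; concatMap; filter; replicate; upTo; length; takeWhile)
open import Data.Nat.ListAction using (sum)
open import Data.List.Membership.DecPropositional _≟_ using (_∈?_)
open import Data.Integer as ℤ using (ℤ)
open import Relation.Nullary using (yes; no)

-- A partition is represented as a non-increasing list of positive parts.
-- partitionsLE m n : all partitions of n with every part ≤ m, each listed once
-- (choose the multiplicity j of the largest allowed part m, then recurse on m - 1).
partitionsLE : ℕ → ℕ → List (List ℕ)
partitionsLE zero zero = [ [] ]
partitionsLE zero (suc _) = []
partitionsLE (suc m) n =
  concatMap (λ j → map (replicate j (suc m) ++_) (partitionsLE m (n ∸ j * suc m)))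
            (filter (λ j → j * suc m ≤? n) (upTo (suc n)))

partitions : ℕ → List (List ℕ)
partitions n = partitionsLE n n

-- mex π : smallest positive integer that is not a part of π.
-- It is 1 + (length of the longest run 1,2,...,r of parts all occurring in π);
-- such a run has r ≤ length π, so scanning 1..length π suffices.
mex : List ℕ → ℕ
mex π = suc (length (takeWhile (λ k → k ∈? π) (map suc (upTo (length π)))))

σmex : ℕ → ℕ
σmex n = sum (map mex (partitions n))

-- f(p) = -1 if p ≡ 5 (mod 12), and 1 otherwise (the theorem only uses p ≡ 5,7,11)
f : ℕ → ℤ
f p with Data.Nat._%_ p 12 ≟ 5
... | yes _ = ℤ.-[1+ 0 ]
... | no _ = ℤ.+ 1

{-# OPTIONS --safe #-}

-- Since mex π = Σ_r [1, …, r are parts of π], the generating function of σmex is ψ/f₁, where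
-- f_k = Π (1 - q^{kn}) and ψ = Σ_{r ≥ 0} q^{r(r+1)/2}. Gauss's identities ψ f₁ = f₂² and
-- f₁² = f₂ φ with φ = Σ_{n ∈ ℤ} (-1)ⁿ q^{n²}, together with φ² ≡ 1 (mod 4), turn it modulo 4 into
-- f₁² and also into f₂ φ. By the pentagonal number theorem f₁ = Σ_{y ≥ 1} χ(y) q^{(y²-1)/24}
-- with χ = (12/·), so modulo 4 σmex N counts, with weights, the solutions of
-- y² + z² = 24N + 2, and also those of y² + 12z² = 12N + 1. A prime p ≡ 3 (mod 4) is inert in ℤ[i]
-- and a prime p ≡ 2 (mod 3) is inert in ℤ[ω], so if 12N + 1 = p²(12M + 1) every solution for N is
-- p times a solution for M; the weights change by the constant sign f(p).
-- The three q-series identities are limits of one functional equation for the partial sums of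
-- the q-binomial series, used in the ring ℤ[[q]]/(4, q^{N+1}).
module Submission where

open import Defs
open import Algebra.Bundles using (CommutativeRing)
import Algebra.Properties.CommutativeSemiring.Binomial
import Algebra.Properties.CommutativeSemiring.Exp
import Algebra.Properties.Semiring.Mult
import Algebra.Properties.Semiring.Sum
import Algebra.Solver.Ring
open import Algebra.Solver.Ring.AlmostCommutativeRing using (_-Raw-AlmostCommutative⟶_; fromCommutativeRing)
open import Data.Empty using (⊥-elim)
open import Data.Fin.Base as Fin using (Fin; toℕ; fromℕ; inject₁)
import Data.Fin.Properties as Fin
open import Data.Integer.Base using (ℤ; +_; -[1+_]; +-*-rawRing)
import Data.Integer.Base as ℤ hiding (+_)
import Data.Integer.Divisibility.Signed as ℤ
import Data.Integer.Properties as ℤ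
import Data.Integer.Tactic.RingSolver as ℤSolver
open import Data.List.Base as List using (List; []; _∷_; _++_; map; filter; concatMap; replicate; upTo; applyUpTo; length; takeWhile; lookup)
open import Data.List.Membership.Propositional using (_∈_; _∉_)
open import Data.List.Membership.Propositional.Properties using (∈-++⁺ʳ; ∈-++⁻)
import Data.List.Properties as List
open import Data.List.Relation.Unary.All as All using (All; []; _∷_)
import Data.List.Relation.Unary.All.Properties as All
open import Data.List.Relation.Unary.Any as Any using (here)
import Data.List.Relation.Unary.Any.Properties as Any
open import Data.Maybe.Base using (just; nothing)
open import Data.Nat.Base as ℕ using (ℕ; zero; suc; _!)
open import Data.Nat.Combinatorics using (_C_; nCk≡n!/k![n-k]!; nCn≡1; k![n∸k]!∣n!)
open import Data.Nat.Divisibility as ℕ using (_∣_)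
import Data.Nat.DivMod as ℕ
open import Data.Nat.ListAction using (sum)
open import Data.Nat.ListAction.Properties using (sum-++)
open import Data.Nat.Primality using (Prime; euclidsLemma; prime⇒nonZero; prime⇒nonTrivial; ¬prime[0])
import Data.Nat.Properties as ℕ
open import Data.List.Membership.DecPropositional ℕ._≟_ using (_∈?_)
import Data.Nat.Tactic.RingSolver as ℕSolver
open import Data.Product using (Σ; ∃₂; _×_; _,_; proj₁; proj₂)
open import Data.Sum using (_⊎_; inj₁; inj₂; [_,_])
open import Function using (_∘_; id)
open import Level using (0ℓ)
open import Relation.Binary.Definitions using (WeaklyDecidable; tri<; tri≈; tri>)
open import Relation.Binary.PropositionalEquality as ≡ using (_≡_; _≢_; refl; cong; cong₂; subst)
import Relation.Binary.Reasoning.Setoid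
open import Relation.Binary.Structures using (IsEquivalence)
open import Relation.Nullary using (¬_; yes; no)
open import Relation.Unary using (Pred; Decidable)

-- One form does not serve all three residue classes. A prime p ≡ 5 (mod 12) splits in ℤ[i], so p
-- may divide y² + z² without dividing y and z; but y² + 12z² = y² + 3(2z)² is a norm from ℤ[ω]. For
-- p ≡ 7 (mod 12) the roles are exchanged. The sign f(p) is read off from the weights: dilation by p
-- multiplies χ(y)χ(z) by χ(p)² = 1, while it multiplies χ(y) times the weight of z in φ by χ(p),
-- which is -1 for p ≡ 5, because the second weight depends only on the parity of z and on whether z
-- is 0. The modulus 4 enters in one place: exactly, ψ/f₁ = f₂/φ, and φ = 1 + 2g gives φ² = 1 + 4(g
-- + g²), so that φ can replace 1/φ. The theta identities follow Shanks: at stage n a product times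
-- a partial sum at z equals a partial theta series, possibly times another product, where z is a
-- power of x up to sign. When x^{n+1} = 0 this z vanishes and the partial sum collapses to its
-- constant term 1, so no limit is taken.

-- Signs, triangular and pentagonal exponents, the character modulo 12

sign : ℕ → ℤ
sign 0 = + 1
sign 1 = -[1+ 0 ]
sign (suc (suc n)) = sign n

sign-suc : ∀ n → sign (suc n) ≡ ℤ.- sign n
sign-suc 0 = refl
sign-suc 1 = refl
sign-suc (suc (suc n)) = sign-suc n

triangular : ℕ → ℕ
triangular zero = 0
triangular (suc n) = triangular n ℕ.+ suc n

2*triangular : ∀ n → 2 ℕ.* triangular n ≡ n ℕ.* suc n
2*triangular zero = refl
2*triangular (suc n) = begin
  2 ℕ.* (triangular n ℕ.+ suc n)       ≡⟨ ℕ.*-distribˡ-+ 2 (triangular n) (suc n) ⟩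
  2 ℕ.* triangular n ℕ.+ 2 ℕ.* suc n   ≡⟨ cong (ℕ._+ 2 ℕ.* suc n) (2*triangular n) ⟩
  n ℕ.* suc n ℕ.+ 2 ℕ.* suc n          ≡⟨ rearrange n ⟩
  suc n ℕ.* suc (suc n)                ∎
  where
  open ≡.≡-Reasoning
  rearrange : ∀ n → n ℕ.* suc n ℕ.+ 2 ℕ.* suc n ≡ suc n ℕ.* suc (suc n)
  rearrange = ℕSolver.solve-∀

n≤triangular : ∀ n → n ℕ.≤ triangular n
n≤triangular zero    = ℕ.z≤n
n≤triangular (suc n) = ℕ.m≤n+m (suc n) (triangular n)

triangular-double : ∀ n → triangular (n ℕ.* 2) ≡ n ℕ.* suc (2 ℕ.* n)
triangular-double n = ℕ.*-cancelˡ-≡ _ _ 2 (≡.trans (2*triangular (n ℕ.* 2)) (rearrange n))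
  where
  rearrange : ∀ n → n ℕ.* 2 ℕ.* suc (n ℕ.* 2) ≡ 2 ℕ.* (n ℕ.* suc (2 ℕ.* n))
  rearrange = ℕSolver.solve-∀

triangular-double+1 : ∀ n → triangular (suc (n ℕ.* 2)) ≡ suc (2 ℕ.* n) ℕ.* suc n
triangular-double+1 n = ≡.trans (cong (ℕ._+ suc (n ℕ.* 2)) (triangular-double n)) (rearrange n)
  where
  rearrange : ∀ n → n ℕ.* suc (2 ℕ.* n) ℕ.+ suc (n ℕ.* 2) ≡ suc (2 ℕ.* n) ℕ.* suc n
  rearrange = ℕSolver.solve-∀

χ : ℕ → ℤ
χ 1  = + 1
χ 5  = -[1+ 0 ]
χ 7  = -[1+ 0 ]
χ 11 = + 1
χ (suc (suc (suc (suc (suc (suc (suc (suc (suc (suc (suc (suc n)))))))))))) = χ n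
χ _  = + 0

-- The coefficient of q^{n²} in φ = Σ_{n ∈ ℤ} (-1)ⁿ q^{n²}.
squareWeight : ℕ → ℤ
squareWeight zero    = + 1
squareWeight (suc n) = + 2 ℤ.* sign (suc n)

-- The division is exact only for y coprime to 6, that is, on the support of χ.
pentagonal : ℕ → ℕ
pentagonal y = (y ℕ.* y ℕ.∸ 1) ℕ./ 24

pentagonal-unique : ∀ y e → y ℕ.* y ≡ suc (e ℕ.* 24) → pentagonal y ≡ e
pentagonal-unique y e eq = ≡.trans (cong (λ w → (w ℕ.∸ 1) ℕ./ 24) eq) (ℕ.m*n/n≡m e 24)

module _ (n : ℕ) where
  private
    t = triangular n

    12t : 24 ℕ.* t ≡ 12 ℕ.* (n ℕ.* suc n)
    12t = ≡.trans (ℕ.*-assoc 12 2 t) (cong (12 ℕ.*_) (2*triangular n))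

  -- With m = n + 1 this is y = 6m - 1 and the exponent m(3m - 1)/2, written as m(m - 1)/2 + m²
  -- because the finite pentagonal identity produces it in that shape. The companion lemma treats y
  -- = 6m + 1, whose exponent is larger by m.
  pentagonal-6n+5 : pentagonal (5 ℕ.+ n ℕ.* 6) ≡ t ℕ.+ suc n ℕ.* suc n
  pentagonal-6n+5 = pentagonal-unique (5 ℕ.+ n ℕ.* 6) _ (begin
    (5 ℕ.+ n ℕ.* 6) ℕ.* (5 ℕ.+ n ℕ.* 6)                  ≡⟨ lhs n ⟩
    suc (12 ℕ.* (n ℕ.* suc n) ℕ.+ 24 ℕ.* (suc n ℕ.* suc n)) ≡⟨ cong (λ w → suc (w ℕ.+ 24 ℕ.* (suc n ℕ.* suc n))) 12t ⟨
    suc (24 ℕ.* t ℕ.+ 24 ℕ.* (suc n ℕ.* suc n))          ≡⟨ rhs t (suc n ℕ.* suc n) ⟩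
    suc ((t ℕ.+ suc n ℕ.* suc n) ℕ.* 24)                 ∎)
    where
    open ≡.≡-Reasoning
    lhs : ∀ n → (5 ℕ.+ n ℕ.* 6) ℕ.* (5 ℕ.+ n ℕ.* 6) ≡ suc (12 ℕ.* (n ℕ.* suc n) ℕ.+ 24 ℕ.* (suc n ℕ.* suc n))
    lhs = ℕSolver.solve-∀
    rhs : ∀ t s → suc (24 ℕ.* t ℕ.+ 24 ℕ.* s) ≡ suc ((t ℕ.+ s) ℕ.* 24)
    rhs = ℕSolver.solve-∀

  pentagonal-6n+7 : pentagonal (7 ℕ.+ n ℕ.* 6) ≡ t ℕ.+ suc n ℕ.* suc n ℕ.+ suc n
  pentagonal-6n+7 = pentagonal-unique (7 ℕ.+ n ℕ.* 6) _ (begin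
    (7 ℕ.+ n ℕ.* 6) ℕ.* (7 ℕ.+ n ℕ.* 6)                  ≡⟨ lhs n ⟩
    suc (12 ℕ.* (n ℕ.* suc n) ℕ.+ 24 ℕ.* (suc n ℕ.* suc n ℕ.+ suc n)) ≡⟨ cong (λ w → suc (w ℕ.+ 24 ℕ.* (suc n ℕ.* suc n ℕ.+ suc n))) 12t ⟨
    suc (24 ℕ.* t ℕ.+ 24 ℕ.* (suc n ℕ.* suc n ℕ.+ suc n))  ≡⟨ rhs t (suc n ℕ.* suc n) (suc n) ⟩
    suc ((t ℕ.+ suc n ℕ.* suc n ℕ.+ suc n) ℕ.* 24)         ∎)
    where
    open ≡.≡-Reasoning
    lhs : ∀ n → (7 ℕ.+ n ℕ.* 6) ℕ.* (7 ℕ.+ n ℕ.* 6) ≡ suc (12 ℕ.* (n ℕ.* suc n) ℕ.+ 24 ℕ.* (suc n ℕ.* suc n ℕ.+ suc n))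
    lhs = ℕSolver.solve-∀
    rhs : ∀ t s u → suc (24 ℕ.* t ℕ.+ 24 ℕ.* (s ℕ.+ u)) ≡ suc ((t ℕ.+ s ℕ.+ u) ℕ.* 24)
    rhs = ℕSolver.solve-∀

-- The values of y from 6n + 2 to 6n + 7 are those added in one step of `pentagonalSum`; only 6n + 5
-- and 6n + 7 survive, with a common sign. The recursion descends by two since χ has period 12.
χ-6n+2 : ∀ n → χ (2 ℕ.+ n ℕ.* 6) ≡ + 0
χ-6n+2 0 = refl
χ-6n+2 1 = refl
χ-6n+2 (suc (suc n)) = χ-6n+2 n

χ-6n+3 : ∀ n → χ (3 ℕ.+ n ℕ.* 6) ≡ + 0
χ-6n+3 0 = refl
χ-6n+3 1 = refl
χ-6n+3 (suc (suc n)) = χ-6n+3 n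

χ-6n+4 : ∀ n → χ (4 ℕ.+ n ℕ.* 6) ≡ + 0
χ-6n+4 0 = refl
χ-6n+4 1 = refl
χ-6n+4 (suc (suc n)) = χ-6n+4 n

χ-6n+5 : ∀ n → χ (5 ℕ.+ n ℕ.* 6) ≡ sign (suc n)
χ-6n+5 0 = refl
χ-6n+5 1 = refl
χ-6n+5 (suc (suc n)) = χ-6n+5 n

χ-6n+6 : ∀ n → χ (6 ℕ.+ n ℕ.* 6) ≡ + 0
χ-6n+6 0 = refl
χ-6n+6 1 = refl
χ-6n+6 (suc (suc n)) = χ-6n+6 n

χ-6n+7 : ∀ n → χ (7 ℕ.+ n ℕ.* 6) ≡ sign (suc n)
χ-6n+7 0 = refl
χ-6n+7 1 = refl
χ-6n+7 (suc (suc n)) = χ-6n+7 n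

-- Theta functions in a commutative ring

module Summation {c ℓ} (K : CommutativeRing c ℓ) where
  private module K = CommutativeRing K
  open CommutativeRing K hiding (zero; refl)

  ∑ : ℕ → (ℕ → Carrier) → Carrier
  ∑ zero    t = 0#
  ∑ (suc n) t = ∑ n t + t n

  ∑-cong : ∀ n {s t} → (∀ i → s i ≈ t i) → ∑ n s ≈ ∑ n t
  ∑-cong zero    s≈t = K.refl
  ∑-cong (suc n) s≈t = +-cong (∑-cong n s≈t) (s≈t n)

  *-distribˡ-∑ : ∀ a n t → a * ∑ n t ≈ ∑ n (λ i → a * t i)
  *-distribˡ-∑ a zero    t = zeroʳ a
  *-distribˡ-∑ a (suc n) t = trans (distribˡ a _ _) (+-congʳ (*-distribˡ-∑ a n t))

  ∑*∑ : ∀ m n s t → ∑ m s * ∑ n t ≈ ∑ m (λ i → ∑ n (λ j → s i * t j))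
  ∑*∑ zero    n s t = zeroˡ _
  ∑*∑ (suc m) n s t = trans (distribʳ _ _ _) (+-cong (∑*∑ m n s t) (*-distribˡ-∑ (s m) n t))

module ThetaIdentities {c ℓ} (K : CommutativeRing c ℓ)
  (ι : +-*-rawRing -Raw-AlmostCommutative⟶ fromCommutativeRing K) where

  private module K = CommutativeRing K
  open CommutativeRing K hiding (zero; refl)
  open _-Raw-AlmostCommutative⟶_ ι using (*-homo; -‿homo; 0-homo; 1-homo) renaming (⟦_⟧ to ⟪_⟫)
  open Algebra.Properties.CommutativeSemiring.Exp commutativeSemiring
  open Relation.Binary.Reasoning.Setoid setoid
  open Summation K

  private
    decideCoefficient : WeaklyDecidable (λ i j → ⟪ i ⟫ ≈ ⟪ j ⟫)
    decideCoefficient i j with i ℤ.≟ j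
    ... | yes p = just (K.reflexive (cong ⟪_⟫ p))
    ... | no _  = nothing

  open Algebra.Solver.Ring +-*-rawRing (fromCommutativeRing K) ι decideCoefficient
    using (solve; _:=_; _:+_; _:*_; _:-_; :-_; _:^_; con; Polynomial)

  private
    -- The solver reads `con (+ 1)` as ⟪ + 1 ⟫, which is not 1# definitionally; an empty power is.
    :1 : ∀ {n} → Polynomial n
    :1 = con (+ 0) :^ 0

  ∏ : ℕ → (ℕ → Carrier) → Carrier
  ∏ zero    t = 1#
  ∏ (suc n) t = ∏ n t * t n

  euler : Carrier → ℕ → Carrier
  euler q n = ∏ n (λ k → 1# - q ^ suc k)

  geometric : Carrier → ℕ → Carrier
  geometric y m = ∑ m (y ^_)

  geometric-sum : ∀ y m → geometric y m * (1# - y) ≈ 1# - y ^ m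
  geometric-sum y zero = begin
    0# * (1# - y) ≈⟨ zeroˡ _ ⟩
    0#            ≈⟨ -‿inverseʳ 1# ⟨
    1# - 1#       ∎
  geometric-sum y (suc m) = begin
    (geometric y m + y ^ m) * (1# - y)
      ≈⟨ solve 3 (λ g Y y → (g :+ Y) :* (:1 :- y) := g :* (:1 :- y) :+ Y :* (:1 :- y)) K.refl _ (y ^ m) y ⟩
    geometric y m * (1# - y) + y ^ m * (1# - y)
      ≈⟨ +-congʳ (geometric-sum y m) ⟩
    (1# - y ^ m) + y ^ m * (1# - y)
      ≈⟨ solve 2 (λ Y y → (:1 :- Y) :+ Y :* (:1 :- y) := :1 :- y :* Y) K.refl (y ^ m) y ⟩
    1# - y ^ suc m ∎

  partialSum : (ℕ → Carrier) → Carrier → ℕ → Carrier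
  partialSum h z m = ∑ (suc m) (λ s → h s * z ^ s)

  partialSum-cong : ∀ h {y z} → y ≈ z → ∀ m → partialSum h y m ≈ partialSum h z m
  partialSum-cong h y≈z zero    = K.refl
  partialSum-cong h y≈z (suc m) = +-cong (partialSum-cong h y≈z m) (*-congˡ (^-congˡ (suc m) y≈z))

  partialSum-0 : ∀ h {z} → z ≈ 0# → ∀ m → partialSum h z m ≈ h 0
  partialSum-0 h z≈0 zero = trans (+-identityˡ _) (*-identityʳ _)
  partialSum-0 h {z} z≈0 (suc m) = begin
    partialSum h z m + h (suc m) * (z * z ^ m)  ≈⟨ +-cong (partialSum-0 h z≈0 m) (*-congˡ (*-congʳ z≈0)) ⟩
    h 0 + h (suc m) * (0# * z ^ m)              ≈⟨ +-congˡ (trans (*-congˡ (zeroˡ _)) (zeroʳ _)) ⟩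
    h 0 + 0#                                    ≈⟨ +-identityʳ _ ⟩
    h 0                                         ∎

  -- Partial sums of the q-binomial series Σ (b - a)(b - aq)⋯(b - aq^{s-1}) z^s / ((1 - q)⋯(1 - q^s)).
  module QBinomial (q a b : Carrier) (r : ℕ → Carrier)
    (r-inverse : ∀ s → r s * (1# - q ^ suc s) ≈ 1#) where

    numerator : ℕ → Carrier
    numerator s = ∏ s (λ k → b - a * q ^ k)

    h : ℕ → Carrier
    h zero    = 1#
    h (suc s) = h s * (b - a * q ^ s) * r s

    h-step : ∀ s → h (suc s) * (1# - q ^ suc s) ≈ h s * (b - a * q ^ s)
    h-step s = trans (*-assoc _ _ _) (trans (*-congˡ (r-inverse s)) (*-identityʳ _))

    euler*h : ∀ s → euler q s * h s ≈ numerator s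
    euler*h zero = *-identityˡ 1#
    euler*h (suc s) = begin
      euler q s * u * h (suc s)
        ≈⟨ solve 3 (λ d u h → d :* u :* h := d :* (h :* u)) K.refl _ u _ ⟩
      euler q s * (h (suc s) * u)
        ≈⟨ *-congˡ (h-step s) ⟩
      euler q s * (h s * w)
        ≈⟨ *-assoc _ _ _ ⟨
      euler q s * h s * w
        ≈⟨ *-congʳ (euler*h s) ⟩
      numerator s * w ∎
      where
      u = 1# - q ^ suc s
      w = b - a * q ^ s

    -- In the limit this is (1 - bz) H(z) = (1 - az) H(qz), which characterises the q-binomial
    -- series. For a partial sum `h-step` telescopes and leaves one boundary term; each application
    -- below turns it into new terms of a theta series.
    functional-equation : ∀ z m →
      (1# - b * z) * partialSum h z m + h m * z ^ suc m * (b - a * q ^ m)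
        ≈ (1# - a * z) * partialSum h (q * z) m
    functional-equation z zero =
      begin
        (1# - b * z) * (0# + 1# * 1#) + 1# * (z * 1#) * (b - a * 1#)
          ≈⟨ +-congʳ (*-congˡ (+-identityˡ _)) ⟩
        (1# - b * z) * (1# * 1#) + 1# * (z * 1#) * (b - a * 1#)
          ≈⟨ solve 3 (λ a b z → (:1 :- b :* z) :* (:1 :* :1) :+ :1 :* (z :* :1) :* (b :- a :* :1)
                        := (:1 :- a :* z) :* (:1 :* :1)) K.refl a b z ⟩
        (1# - a * z) * (1# * 1#)
          ≈⟨ *-congˡ (+-identityˡ _) ⟨
        (1# - a * z) * (0# + 1# * 1#) ∎
    functional-equation z (suc m) = begin
      (1# - b * z) * (U + h′ * Z) + h′ * (z * Z) * (b - a * q′)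
        -- The terms with `b` and `h′` cancel, leaving h′ Z (1 - a z q′), and 1 - a z q′ = (1 - q′)
        -- + q′ (1 - a z): the first part is ready for `h-step`, the second is the new summand at q
        -- z.
        ≈⟨ solve 7 (λ a b z U h′ Z q′ →
             (:1 :- b :* z) :* (U :+ h′ :* Z) :+ h′ :* (z :* Z) :* (b :- a :* q′)
             := (:1 :- b :* z) :* U :+ h′ :* (:1 :- q′) :* Z :+ (:1 :- a :* z) :* (h′ :* (q′ :* Z)))
             K.refl a b z U h′ Z q′ ⟩
      (1# - b * z) * U + h′ * (1# - q′) * Z + (1# - a * z) * (h′ * (q′ * Z))
        ≈⟨ +-congʳ (+-congˡ (*-congʳ (h-step m))) ⟩
      (1# - b * z) * U + h m * (b - a * q ^ m) * Z + (1# - a * z) * (h′ * (q′ * Z))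
        ≈⟨ +-congʳ (+-congˡ (solve 3 (λ h w Z → h :* w :* Z := h :* Z :* w) K.refl (h m) _ Z)) ⟩
      (1# - b * z) * U + h m * Z * (b - a * q ^ m) + (1# - a * z) * (h′ * (q′ * Z))
        ≈⟨ +-congʳ (functional-equation z m) ⟩
      (1# - a * z) * partialSum h (q * z) m + (1# - a * z) * (h′ * (q′ * Z))
        ≈⟨ distribˡ _ _ _ ⟨
      (1# - a * z) * (partialSum h (q * z) m + h′ * (q′ * Z))
        ≈⟨ *-congˡ (+-congˡ (*-congˡ (^-distrib-* q z (suc m)))) ⟨
      (1# - a * z) * (partialSum h (q * z) m + h′ * (q * z) ^ suc m) ∎
      where
      U = partialSum h z m
      h′ = h (suc m)
      Z = z ^ suc m
      q′ = q ^ suc m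

  pentagonalTerm : Carrier → ℕ → Carrier
  pentagonalTerm x y = ⟪ χ y ⟫ * x ^ pentagonal y

  pentagonalSum : Carrier → ℕ → Carrier
  pentagonalSum x n = ∑ (2 ℕ.+ n ℕ.* 6) (pentagonalTerm x)

  squareSum : Carrier → ℕ → Carrier
  squareSum x n = ∑ (suc n) (λ y → ⟪ squareWeight y ⟫ * x ^ (y ℕ.* y))

  eulerPlus : Carrier → ℕ → Carrier
  eulerPlus x n = ∏ n (λ k → 1# + x ^ suc k)

  triangularSum : Carrier → ℕ → Carrier
  triangularSum x n = ∑ n (λ s → x ^ triangular s)

  eulerOdd : Carrier → ℕ → Carrier
  eulerOdd x n = ∏ n (λ k → 1# - x * (x * x) ^ k)

  sign-suc′ : ∀ n → ⟪ sign (suc n) ⟫ ≈ - ⟪ sign n ⟫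
  sign-suc′ n = trans (K.reflexive (cong ⟪_⟫ (sign-suc n))) (-‿homo (sign n))

  module _ (x : Carrier) (r : ℕ → Carrier) (r-inverse : ∀ s → r s * (1# - x ^ suc s) ≈ 1#) where

    private
      module B = QBinomial x ⟪ + 1 ⟫ ⟪ + 0 ⟫ r r-inverse

      numerator-monomial : ∀ n → B.numerator (suc n) ≈ ⟪ sign (suc n) ⟫ * x ^ triangular n
      numerator-monomial zero =
        solve 0 (:1 :* (con (+ 0) :- con (+ 1) :* :1) := con -[1+ 0 ] :* :1) K.refl
      numerator-monomial (suc n) = begin
        B.numerator (suc n) * (⟪ + 0 ⟫ - ⟪ + 1 ⟫ * x ^ suc n)
          ≈⟨ *-congʳ (numerator-monomial n) ⟩
        ⟪ sign (suc n) ⟫ * x ^ triangular n * (⟪ + 0 ⟫ - ⟪ + 1 ⟫ * x ^ suc n)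
          ≈⟨ solve 3 (λ s t u → s :* t :* (con (+ 0) :- con (+ 1) :* u) := (:- s) :* (t :* u))
               K.refl ⟪ sign (suc n) ⟫ (x ^ triangular n) (x ^ suc n) ⟩
        - ⟪ sign (suc n) ⟫ * (x ^ triangular n * x ^ suc n)
          ≈⟨ *-cong (sign-suc′ (suc n)) (^-homo-* x (triangular n) (suc n)) ⟨
        ⟪ sign (suc (suc n)) ⟫ * x ^ triangular (suc n) ∎

      vanishing : ∀ y → χ y ≡ + 0 → pentagonalTerm x y ≈ 0#
      vanishing y eq = trans (*-congʳ (trans (K.reflexive (cong ⟪_⟫ eq)) 0-homo)) (zeroˡ _)

      term : ∀ y {s e} → χ y ≡ s → pentagonal y ≡ e → pentagonalTerm x y ≈ ⟪ s ⟫ * x ^ e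
      term y refl refl = K.refl

      pentagonalSum-step : ∀ n → pentagonalSum x (suc n) ≈
        pentagonalSum x n + B.numerator (suc n) * (x ^ suc n) ^ suc n * (1# + x ^ suc n)
      pentagonalSum-step n = begin
        P + t 2 + t 3 + t 4 + t 5 + t 6 + t 7
          ≈⟨ +-cong (+-cong (+-cong (+-cong (+-cong (+-congˡ
               (vanishing (2 ℕ.+ m) (χ-6n+2 n))) (vanishing (3 ℕ.+ m) (χ-6n+3 n))) (vanishing (4 ℕ.+ m) (χ-6n+4 n)))
               (term (5 ℕ.+ m) (χ-6n+5 n) (pentagonal-6n+5 n))) (vanishing (6 ℕ.+ m) (χ-6n+6 n)))
               (term (7 ℕ.+ m) (χ-6n+7 n) (pentagonal-6n+7 n)) ⟩
        P + 0# + 0# + 0# + s * x ^ (T ℕ.+ Q) + 0# + s * x ^ (T ℕ.+ Q ℕ.+ suc n)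
          ≈⟨ +-cong (trans (+-identityʳ _) (+-congʳ (trans (+-identityʳ _) (trans (+-identityʳ _) (+-identityʳ _)))))
               (*-congˡ (^-homo-* x (T ℕ.+ Q) (suc n))) ⟩
        P + s * x ^ (T ℕ.+ Q) + s * (x ^ (T ℕ.+ Q) * X)
          ≈⟨ +-cong (+-congˡ (*-congˡ split)) (*-congˡ (*-congʳ split)) ⟩
        P + s * (x ^ T * X ^ suc n) + s * (x ^ T * X ^ suc n * X)
          ≈⟨ solve 5 (λ P s t Z X → P :+ s :* (t :* Z) :+ s :* (t :* Z :* X) := P :+ s :* t :* Z :* (:1 :+ X))
               K.refl P s (x ^ T) (X ^ suc n) X ⟩
        P + s * x ^ T * X ^ suc n * (1# + X)
          ≈⟨ +-congˡ (*-congʳ (*-congʳ (numerator-monomial n))) ⟨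
        P + B.numerator (suc n) * X ^ suc n * (1# + X) ∎
        where
        m = n ℕ.* 6
        t = λ k → pentagonalTerm x (k ℕ.+ m)
        P = pentagonalSum x n
        s = ⟪ sign (suc n) ⟫
        T = triangular n
        Q = suc n ℕ.* suc n
        X = x ^ suc n
        split : x ^ (T ℕ.+ Q) ≈ x ^ T * X ^ suc n
        split = trans (^-homo-* x T Q) (*-congˡ (sym (^-assocʳ x (suc n) (suc n))))

    -- Shanks's finite form of the theorem. The functional equation at z = X trades the new factor 1
    -- - X of the product for the move from x^{n+1} to x^{n+2}. What is left over is h′ X^{n+1} (1 -
    -- X²); times the old product this is the numerator times X^{n+1} (1 + X), that is, the two
    -- pentagonal terms with m = n + 1.
    finite-pentagonal : ∀ n → euler x n * partialSum B.h (x ^ suc n) n ≈ pentagonalSum x n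
    finite-pentagonal zero = begin
      1# * (0# + 1# * 1#)
        ≈⟨ trans (*-identityˡ _) (trans (+-identityˡ _) (*-identityˡ _)) ⟩
      1#
        ≈⟨ trans (+-cong (trans (+-identityˡ _) (trans (*-congʳ 0-homo) (zeroˡ _))) (trans (*-identityʳ _) 1-homo)) (+-identityˡ _) ⟨
      0# + ⟪ + 0 ⟫ * 1# + ⟪ + 1 ⟫ * 1# ∎
    finite-pentagonal (suc n) = begin
      A * (1# - X) * partialSum B.h (x * X) (suc n)
        ≈⟨ solve 3 (λ A X U → A :* (:1 :- X) :* U := A :* ((:1 :- con (+ 1) :* X) :* U)) K.refl A X _ ⟩
      A * ((1# - ⟪ + 1 ⟫ * X) * partialSum B.h (x * X) (suc n))
        ≈⟨ *-congˡ (B.functional-equation X (suc n)) ⟨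
      A * ((1# - ⟪ + 0 ⟫ * X) * (U + h′ * X ^ suc n) + h′ * (X * X ^ suc n) * (⟪ + 0 ⟫ - ⟪ + 1 ⟫ * X))
        ≈⟨ solve 5 (λ A X U h Z →
             A :* ((:1 :- con (+ 0) :* X) :* (U :+ h :* Z) :+ h :* (X :* Z) :* (con (+ 0) :- con (+ 1) :* X))
             := A :* U :+ A :* (:1 :- X) :* h :* Z :* (:1 :+ X)) K.refl A X U h′ (X ^ suc n) ⟩
      A * U + A * (1# - X) * h′ * X ^ suc n * (1# + X)
        ≈⟨ +-cong (finite-pentagonal n) (*-congʳ (*-congʳ (B.euler*h (suc n)))) ⟩
      pentagonalSum x n + B.numerator (suc n) * X ^ suc n * (1# + X)
        ≈⟨ pentagonalSum-step n ⟨
      pentagonalSum x (suc n) ∎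
      where
      A = euler x n
      X = x ^ suc n
      U = partialSum B.h X n
      h′ = B.h (suc n)

    pentagonal-number-theorem : ∀ n → x ^ suc n ≈ 0# → euler x n ≈ pentagonalSum x n
    pentagonal-number-theorem n xⁿ⁺¹≈0 = begin
      euler x n                                     ≈⟨ *-identityʳ _ ⟨
      euler x n * 1#                                ≈⟨ *-congˡ (partialSum-0 B.h xⁿ⁺¹≈0 n) ⟨
      euler x n * partialSum B.h (x ^ suc n) n      ≈⟨ finite-pentagonal n ⟩
      pentagonalSum x n                               ∎

  module _ (x : Carrier) (r : ℕ → Carrier) (r-inverse : ∀ s → r s * (1# - x ^ suc s) ≈ 1#) where

    private
      module B = QBinomial x ⟪ -[1+ 0 ] ⟫ ⟪ + 1 ⟫ r r-inverse

      -- The factor at k = 0 is 1 + 1; it becomes the coefficient 2 of the positive squares in φ.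
      numerator-eulerPlus : ∀ n → B.numerator (suc n) ≈ (1# + 1#) * eulerPlus x n
      numerator-eulerPlus zero =
        solve 0 (:1 :* (con (+ 1) :- con -[1+ 0 ] :* :1) := (:1 :+ :1) :* :1) K.refl
      numerator-eulerPlus (suc n) = begin
        B.numerator (suc n) * (⟪ + 1 ⟫ - ⟪ -[1+ 0 ] ⟫ * x ^ suc n)
          ≈⟨ *-congʳ (numerator-eulerPlus n) ⟩
        (1# + 1#) * eulerPlus x n * (⟪ + 1 ⟫ - ⟪ -[1+ 0 ] ⟫ * x ^ suc n)
          ≈⟨ solve 2 (λ B X → (:1 :+ :1) :* B :* (con (+ 1) :- con -[1+ 0 ] :* X) := (:1 :+ :1) :* (B :* (:1 :+ X)))
               K.refl (eulerPlus x n) (x ^ suc n) ⟩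
        (1# + 1#) * eulerPlus x (suc n) ∎

      -1^ : ∀ n → ⟪ -[1+ 0 ] ⟫ ^ n ≈ ⟪ sign n ⟫
      -1^ zero = sym 1-homo
      -1^ (suc n) = begin
        ⟪ -[1+ 0 ] ⟫ * ⟪ -[1+ 0 ] ⟫ ^ n  ≈⟨ *-congˡ (-1^ n) ⟩
        ⟪ -[1+ 0 ] ⟫ * ⟪ sign n ⟫        ≈⟨ solve 1 (λ s → con -[1+ 0 ] :* s := :- s) K.refl ⟪ sign n ⟫ ⟩
        - ⟪ sign n ⟫                     ≈⟨ sign-suc′ n ⟨
        ⟪ sign (suc n) ⟫                 ∎

      square-term : ∀ n → ⟪ squareWeight (suc n) ⟫ * x ^ (suc n ℕ.* suc n) ≈
        (1# + 1#) * (⟪ -[1+ 0 ] ⟫ * x ^ suc n) ^ suc n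
      square-term n = begin
        ⟪ + 2 ℤ.* sign (suc n) ⟫ * x ^ (suc n ℕ.* suc n)
          ≈⟨ *-cong (*-homo (+ 2) (sign (suc n))) (sym (^-assocʳ x (suc n) (suc n))) ⟩
        ⟪ + 2 ⟫ * ⟪ sign (suc n) ⟫ * (x ^ suc n) ^ suc n
          ≈⟨ solve 2 (λ s X → con (+ 2) :* s :* X := (:1 :+ :1) :* (s :* X)) K.refl ⟪ sign (suc n) ⟫ _ ⟩
        (1# + 1#) * (⟪ sign (suc n) ⟫ * (x ^ suc n) ^ suc n)
          ≈⟨ *-congˡ (*-congʳ (-1^ (suc n))) ⟨
        (1# + 1#) * (⟪ -[1+ 0 ] ⟫ ^ suc n * (x ^ suc n) ^ suc n)
          ≈⟨ *-congˡ (^-distrib-* ⟪ -[1+ 0 ] ⟫ (x ^ suc n) (suc n)) ⟨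
        (1# + 1#) * (⟪ -[1+ 0 ] ⟫ * x ^ suc n) ^ suc n ∎

    -- With a = -1, b = 1 and z = -X the two factors of the functional equation are 1 - a z = 1 - X
    -- and 1 - b z = 1 + X, which are exactly the new factors of `euler` and `eulerPlus`.
    finite-gauss-square : ∀ n →
      euler x n * partialSum B.h (⟪ -[1+ 0 ] ⟫ * x ^ suc n) n ≈ eulerPlus x n * squareSum x n
    finite-gauss-square zero =
      *-congˡ (+-congˡ (*-congʳ (sym 1-homo)))
    finite-gauss-square (suc n) = begin
      A * (1# - X) * partialSum B.h (⟪ -[1+ 0 ] ⟫ * (x * X)) (suc n)
        ≈⟨ *-congˡ (partialSum-cong B.h (solve 2 (λ x X → con -[1+ 0 ] :* (x :* X) := x :* (con -[1+ 0 ] :* X)) K.refl x X) (suc n)) ⟩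
      A * (1# - X) * partialSum B.h (x * z) (suc n)
        ≈⟨ solve 3 (λ A X U → A :* (:1 :- X) :* U := A :* ((:1 :- con -[1+ 0 ] :* (con -[1+ 0 ] :* X)) :* U)) K.refl A X _ ⟩
      A * ((1# - ⟪ -[1+ 0 ] ⟫ * z) * partialSum B.h (x * z) (suc n))
        ≈⟨ *-congˡ (B.functional-equation z (suc n)) ⟨
      A * ((1# - ⟪ + 1 ⟫ * z) * (U + h′ * z ^ suc n) + h′ * (z * z ^ suc n) * (⟪ + 1 ⟫ - ⟪ -[1+ 0 ] ⟫ * X))
        ≈⟨ solve 5 (λ A X U h Z →
             A :* ((:1 :- con (+ 1) :* (con -[1+ 0 ] :* X)) :* (U :+ h :* Z)
               :+ h :* ((con -[1+ 0 ] :* X) :* Z) :* (con (+ 1) :- con -[1+ 0 ] :* X))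
             := (:1 :+ X) :* (A :* U :+ A :* (:1 :- X) :* h :* Z)) K.refl A X U h′ (z ^ suc n) ⟩
      (1# + X) * (A * U + A * (1# - X) * h′ * z ^ suc n)
        ≈⟨ *-congˡ (+-cong (finite-gauss-square n) (*-congʳ (trans (B.euler*h (suc n)) (numerator-eulerPlus n)))) ⟩
      (1# + X) * (eulerPlus x n * squareSum x n + (1# + 1#) * eulerPlus x n * z ^ suc n)
        ≈⟨ solve 4 (λ X B P Z → (:1 :+ X) :* (B :* P :+ (:1 :+ :1) :* B :* Z)
             := B :* (:1 :+ X) :* (P :+ (:1 :+ :1) :* Z)) K.refl X (eulerPlus x n) (squareSum x n) (z ^ suc n) ⟩
      eulerPlus x n * (1# + X) * (squareSum x n + (1# + 1#) * z ^ suc n)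
        ≈⟨ *-congˡ (+-congˡ (square-term n)) ⟨
      eulerPlus x (suc n) * squareSum x (suc n) ∎
      where
      A = euler x n
      X = x ^ suc n
      z = ⟪ -[1+ 0 ] ⟫ * X
      U = partialSum B.h z n
      h′ = B.h (suc n)

    gauss-square : ∀ n → x ^ suc n ≈ 0# → eulerPlus x n * squareSum x n ≈ euler x n
    gauss-square n xⁿ⁺¹≈0 = begin
      eulerPlus x n * squareSum x n
        ≈⟨ finite-gauss-square n ⟨
      euler x n * partialSum B.h (⟪ -[1+ 0 ] ⟫ * x ^ suc n) n
        ≈⟨ *-congˡ (partialSum-0 B.h (trans (*-congˡ xⁿ⁺¹≈0) (zeroʳ _)) n) ⟩
      euler x n * 1#
        ≈⟨ *-identityʳ _ ⟩
      euler x n ∎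

  module _ (x : Carrier) (r : ℕ → Carrier) (r-inverse : ∀ s → r s * (1# - (x * x) ^ suc s) ≈ 1#) where

    private
      module B = QBinomial (x * x) x 1# r r-inverse

      odd-power : ∀ n → x * (x * x) ^ n ≈ x ^ suc (2 ℕ.* n)
      odd-power n = *-congˡ (trans (^-congˡ n (*-congˡ (sym (*-identityʳ x)))) (^-assocʳ x 2 n))

      odd-power^ : ∀ n k {e} → suc (2 ℕ.* n) ℕ.* k ≡ e → (x * (x * x) ^ n) ^ k ≈ x ^ e
      odd-power^ n k eq = trans (^-congˡ k (odd-power n)) (trans (^-assocʳ x (suc (2 ℕ.* n)) k) (^-congʳ x eq))

    -- The base is x², with a = x, b = 1 and z = x^{2n+1}, so a z = x^{2n+2} supplies the new factor
    -- of `euler` and b z = z that of `eulerOdd`. Here the functional equation is applied at m = n,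
    -- before the last summand of the partial sum: the boundary term gives the exponent
    -- `triangular (2n + 1)` and the last summand `triangular (2n + 2)`.
    finite-gauss-triangular : ∀ n →
      euler (x * x) n * partialSum B.h (x * (x * x) ^ n) n ≈ eulerOdd x n * triangularSum x (suc (n ℕ.* 2))
    finite-gauss-triangular zero = *-congˡ (+-congˡ (*-identityˡ 1#))
    finite-gauss-triangular (suc n) = begin
      D * (1# - q * q ^ n) * (partialSum B.h (x * (q * q ^ n)) n + h′ * (x * (q * q ^ n)) ^ suc n)
        ≈⟨ *-congˡ (+-congʳ (partialSum-cong B.h (solve 3 (λ x q Q → x :* (q :* Q) := q :* (x :* Q)) K.refl x q (q ^ n)) n)) ⟩
      D * (1# - q * q ^ n) * (partialSum B.h (q * z) n + h′ * (x * (q * q ^ n)) ^ suc n)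
        ≈⟨ solve 6 (λ x D Q U h Y → D :* (:1 :- x :* x :* Q) :* (U :+ h :* Y)
             := D :* ((:1 :- x :* (x :* Q)) :* U) :+ D :* (:1 :- x :* x :* Q) :* h :* Y)
             K.refl x D (q ^ n) _ h′ _ ⟩
      D * ((1# - x * z) * partialSum B.h (q * z) n) + euler q (suc n) * h′ * Y
        ≈⟨ +-cong (*-congˡ (B.functional-equation z n)) K.refl ⟨
      D * ((1# - 1# * z) * U + B.h n * z ^ suc n * (1# - z)) + euler q (suc n) * h′ * Y
        ≈⟨ +-cong (solve 5 (λ D z U h Z → D :* ((:1 :- :1 :* z) :* U :+ h :* Z :* (:1 :- z))
             := (:1 :- z) :* (D :* U :+ D :* h :* Z)) K.refl D z U (B.h n) (z ^ suc n)) (*-congʳ (B.euler*h (suc n))) ⟩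
      (1# - z) * (D * U + D * B.h n * z ^ suc n) + eulerOdd x n * (1# - z) * Y
        ≈⟨ +-congʳ (*-congˡ (+-cong (finite-gauss-triangular n) (*-congʳ (B.euler*h n)))) ⟩
      (1# - z) * (eulerOdd x n * P + eulerOdd x n * z ^ suc n) + eulerOdd x n * (1# - z) * Y
        ≈⟨ solve 5 (λ z O P Z Y → (:1 :- z) :* (O :* P :+ O :* Z) :+ O :* (:1 :- z) :* Y
             := O :* (:1 :- z) :* (P :+ Z :+ Y)) K.refl z (eulerOdd x n) P (z ^ suc n) Y ⟩
      eulerOdd x n * (1# - z) * (P + z ^ suc n + Y)
        ≈⟨ *-congˡ (+-cong (+-congˡ (odd-power^ n (suc n) (≡.sym (triangular-double+1 n))))
             (odd-power^ (suc n) (suc n) (≡.sym (≡.trans (triangular-double (suc n)) (ℕ.*-comm (suc n) _))))) ⟩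
      eulerOdd x (suc n) * triangularSum x (suc (suc n ℕ.* 2)) ∎
      where
      q = x * x
      D = euler q n
      z = x * q ^ n
      U = partialSum B.h z n
      P = triangularSum x (suc (n ℕ.* 2))
      h′ = B.h (suc n)
      Y = (x * (q * q ^ n)) ^ suc n

    gauss-triangular : ∀ n → x ^ suc n ≈ 0# → eulerOdd x n * triangularSum x (suc (n ℕ.* 2)) ≈ euler (x * x) n
    gauss-triangular n xⁿ⁺¹≈0 = begin
      eulerOdd x n * triangularSum x (suc (n ℕ.* 2))
        ≈⟨ finite-gauss-triangular n ⟨
      euler (x * x) n * partialSum B.h (x * (x * x) ^ n) n
        ≈⟨ *-congˡ (partialSum-0 B.h z≈0 n) ⟩
      euler (x * x) n * 1#
        ≈⟨ *-identityʳ _ ⟩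
      euler (x * x) n ∎
      where
      z≈0 : x * (x * x) ^ n ≈ 0#
      z≈0 = begin
        x * (x * x) ^ n      ≈⟨ *-congˡ (^-distrib-* x x n) ⟩
        x * (x ^ n * x ^ n)  ≈⟨ *-assoc _ _ _ ⟨
        x ^ suc n * x ^ n    ≈⟨ *-congʳ xⁿ⁺¹≈0 ⟩
        0# * x ^ n           ≈⟨ zeroˡ _ ⟩
        0#                   ∎

  module _ (x : Carrier) (T F : ℕ → Carrier) (T₀≈1 : T 0 ≈ 1#) (F₀≈1 : F 0 ≈ 1#)
    (T-step : ∀ m → T (suc m) + x ^ suc m * T m ≈ T m + x ^ suc m * (T (suc m) + (T m + F m)))
    (F-step : ∀ m → F (suc m) ≈ x ^ suc m * (F (suc m) + F m)) where

    -- `F-step` amounts to (1 - X) F (m + 1) = X F m, so the exponents 1, ..., m accumulate. For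
    -- partitions with parts at most m that contain each of 1, ..., m, these are the obligatory
    -- parts.
    euler*F : ∀ m → euler x m * F m ≈ x ^ triangular m
    euler*F zero = trans (*-identityˡ _) F₀≈1
    euler*F (suc m) = begin
      euler x m * (1# - X) * F (suc m)
        ≈⟨ solve 3 (λ A X F′ → A :* (:1 :- X) :* F′ := A :* (F′ :- X :* F′)) K.refl (euler x m) X (F (suc m)) ⟩
      euler x m * (F (suc m) - X * F (suc m))
        ≈⟨ *-congˡ (+-congʳ (F-step m)) ⟩
      euler x m * (X * (F (suc m) + F m) - X * F (suc m))
        ≈⟨ solve 4 (λ A X F′ F → A :* (X :* (F′ :+ F) :- X :* F′) := A :* F :* X) K.refl (euler x m) X (F (suc m)) (F m) ⟩
      euler x m * F m * X
        ≈⟨ *-congʳ (euler*F m) ⟩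
      x ^ triangular m * X
        ≈⟨ ^-homo-* x (triangular m) (suc m) ⟨
      x ^ triangular (suc m) ∎
      where X = x ^ suc m

    -- `T-step` amounts to (1 - X) T (m + 1) = T m + X F m, and by `euler*F` each step adds one
    -- triangular power. Both step hypotheses are kept free of subtraction because they come from
    -- identities between numbers of partitions in ℕ.
    euler*T : ∀ m → euler x m * T m ≈ triangularSum x (suc m)
    euler*T zero = begin
      1# * T 0     ≈⟨ trans (*-identityˡ _) T₀≈1 ⟩
      1#           ≈⟨ +-identityˡ 1# ⟨
      0# + 1#      ∎
    euler*T (suc m) = begin
      euler x m * (1# - X) * T (suc m)
        ≈⟨ solve 4 (λ A X T′ T → A :* (:1 :- X) :* T′ := A :* ((T′ :+ X :* T) :- X :* (T′ :+ T)))
             K.refl (euler x m) X (T (suc m)) (T m) ⟩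
      euler x m * ((T (suc m) + X * T m) - X * (T (suc m) + T m))
        ≈⟨ *-congˡ (+-congʳ (T-step m)) ⟩
      euler x m * ((T m + X * (T (suc m) + (T m + F m))) - X * (T (suc m) + T m))
        ≈⟨ solve 5 (λ A X T′ T F → A :* ((T :+ X :* (T′ :+ (T :+ F))) :- X :* (T′ :+ T)) := A :* T :+ A :* F :* X)
             K.refl (euler x m) X (T (suc m)) (T m) (F m) ⟩
      euler x m * T m + euler x m * F m * X
        ≈⟨ +-cong (euler*T m) (*-congʳ (euler*F m)) ⟩
      triangularSum x (suc m) + x ^ triangular m * X
        ≈⟨ +-congˡ (^-homo-* x (triangular m) (suc m)) ⟨
      triangularSum x (suc (suc m)) ∎
      where X = x ^ suc m

  module Truncated (x : Carrier) (N : ℕ) (xᴺ⁺¹≈0 : x ^ suc N ≈ 0#) where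

    x^-vanish : ∀ k → suc N ℕ.≤ k → x ^ k ≈ 0#
    x^-vanish k N<k = begin
      x ^ k                            ≈⟨ ^-congʳ x (ℕ.m+[n∸m]≡n N<k) ⟨
      x ^ (suc N ℕ.+ (k ℕ.∸ suc N))    ≈⟨ ^-homo-* x (suc N) _ ⟩
      x ^ suc N * x ^ (k ℕ.∸ suc N)    ≈⟨ *-congʳ xᴺ⁺¹≈0 ⟩
      0# * x ^ (k ℕ.∸ suc N)           ≈⟨ zeroˡ _ ⟩
      0#                               ∎

    reciprocal : Carrier → ℕ → Carrier
    reciprocal y s = geometric (y ^ suc s) (suc N)

    -- A nilpotent y makes the geometric series finite, so every 1 - y^{s+1} is a unit; the
    -- truncation thus provides the divisions that the q-binomial coefficients `h` require.
    reciprocal-inverse : ∀ y → y ^ suc N ≈ 0# → ∀ s → reciprocal y s * (1# - y ^ suc s) ≈ 1#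
    reciprocal-inverse y yᴺ⁺¹≈0 s = begin
      reciprocal y s * (1# - y ^ suc s)  ≈⟨ geometric-sum (y ^ suc s) (suc N) ⟩
      1# - (y ^ suc s) ^ suc N           ≈⟨ +-congˡ (-‿cong vanish) ⟩
      1# - 0#                            ≈⟨ trans (+-congˡ ε⁻¹≈ε) (+-identityʳ 1#) ⟩
      1#                                 ∎
      where
      open import Algebra.Properties.Group +-group using (ε⁻¹≈ε)
      vanish : (y ^ suc s) ^ suc N ≈ 0#
      vanish = begin
        (y ^ suc s) ^ suc N              ≈⟨ ^-assocʳ y (suc s) (suc N) ⟩
        y ^ (suc N ℕ.+ s ℕ.* suc N)      ≈⟨ ^-homo-* y (suc N) _ ⟩
        y ^ suc N * y ^ (s ℕ.* suc N)    ≈⟨ *-congʳ yᴺ⁺¹≈0 ⟩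
        0# * y ^ (s ℕ.* suc N)           ≈⟨ zeroˡ _ ⟩
        0#                               ∎

    [x*x]ᴺ⁺¹≈0 : (x * x) ^ suc N ≈ 0#
    [x*x]ᴺ⁺¹≈0 = trans (^-distrib-* x x (suc N)) (trans (*-congʳ xᴺ⁺¹≈0) (zeroˡ _))

    r r₂ : ℕ → Carrier
    r = reciprocal x
    r₂ = reciprocal (x * x)

    r-inverse : ∀ s → r s * (1# - x ^ suc s) ≈ 1#
    r-inverse = reciprocal-inverse x xᴺ⁺¹≈0

    r₂-inverse : ∀ s → r₂ s * (1# - (x * x) ^ suc s) ≈ 1#
    r₂-inverse = reciprocal-inverse (x * x) [x*x]ᴺ⁺¹≈0

    -- `A` and `D` are the products f₁ and f₂, with `E` and `E₂` their pentagonal series; `B` and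
    -- `O` are the products of 1 + x^k over all k ≥ 1 and of 1 - x^k over odd k. All are cut off at
    -- N.
    E E₂ Φ A B D O : Carrier
    E  = pentagonalSum x N
    E₂ = pentagonalSum (x * x) N
    Φ  = squareSum x N
    A  = euler x N
    B  = eulerPlus x N
    D  = euler (x * x) N
    O  = eulerOdd x N

    euler*eulerPlus : ∀ n → euler x n * eulerPlus x n ≈ euler (x * x) n
    euler*eulerPlus zero = *-identityˡ 1#
    euler*eulerPlus (suc n) = begin
      euler x n * (1# - X) * (eulerPlus x n * (1# + X))
        ≈⟨ solve 3 (λ A B X → A :* (:1 :- X) :* (B :* (:1 :+ X)) := A :* B :* (:1 :- X :* X)) K.refl _ _ X ⟩
      euler x n * eulerPlus x n * (1# - X * X)
        ≈⟨ *-cong (euler*eulerPlus n) (+-congˡ (-‿cong (sym (^-distrib-* x x (suc n))))) ⟩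
      euler (x * x) (suc n) ∎
      where X = x ^ suc n

    eulerOdd*euler : ∀ n → eulerOdd x n * euler (x * x) n ≈ euler x (n ℕ.* 2)
    eulerOdd*euler zero = *-identityˡ 1#
    eulerOdd*euler (suc n) = begin
      eulerOdd x n * (1# - x * Q) * (euler (x * x) n * (1# - x * x * Q))
        ≈⟨ solve 4 (λ O D x Q → O :* (:1 :- x :* Q) :* (D :* (:1 :- x :* x :* Q))
             := O :* D :* (:1 :- x :* Q) :* (:1 :- x :* (x :* Q))) K.refl _ _ x Q ⟩
      eulerOdd x n * euler (x * x) n * (1# - x * Q) * (1# - x * (x * Q))
        ≈⟨ *-cong (*-cong (eulerOdd*euler n) (+-congˡ (-‿cong (*-congˡ Q≈))))
             (+-congˡ (-‿cong (*-congˡ (*-congˡ Q≈)))) ⟩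
      euler x (suc n ℕ.* 2) ∎
      where
      Q = (x * x) ^ n
      Q≈ : Q ≈ x ^ (n ℕ.* 2)
      Q≈ = trans (^-congˡ n (*-congˡ (sym (*-identityʳ x))))
             (trans (^-assocʳ x 2 n) (^-congʳ x (ℕ.*-comm 2 n)))

    -- Interleaving odd and even factors at stage N gives 2N factors of f₁, and Gauss's triangular
    -- identity has 2N + 1 terms, against N and N + 1 wanted. The surplus involves only powers x^k
    -- with k > N, so surplus factors are 1 and, in `triangularSum-stable`, surplus terms are 0.
    euler-stable : ∀ j → euler x (j ℕ.+ N) ≈ A
    euler-stable zero = K.refl
    euler-stable (suc j) = begin
      euler x (j ℕ.+ N) * (1# - x ^ suc (j ℕ.+ N))
        ≈⟨ *-cong (euler-stable j) (+-congˡ (-‿cong (x^-vanish _ (ℕ.s≤s (ℕ.m≤n+m N j))))) ⟩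
      A * (1# - 0#)
        ≈⟨ *-congˡ (trans (+-congˡ ε⁻¹≈ε) (+-identityʳ 1#)) ⟩
      A * 1#
        ≈⟨ *-identityʳ A ⟩
      A ∎
      where open import Algebra.Properties.Group +-group using (ε⁻¹≈ε)

    triangularSum-stable : ∀ j → triangularSum x (j ℕ.+ suc N) ≈ triangularSum x (suc N)
    triangularSum-stable zero = K.refl
    triangularSum-stable (suc j) = begin
      triangularSum x (j ℕ.+ suc N) + x ^ triangular (j ℕ.+ suc N)
        ≈⟨ +-cong (triangularSum-stable j) (x^-vanish _ (ℕ.≤-trans (ℕ.m≤n+m (suc N) j) (n≤triangular (j ℕ.+ suc N)))) ⟩
      triangularSum x (suc N) + 0#
        ≈⟨ +-identityʳ _ ⟩
      triangularSum x (suc N) ∎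

    A≈E : A ≈ E
    A≈E = pentagonal-number-theorem x r r-inverse N xᴺ⁺¹≈0

    D≈E₂ : D ≈ E₂
    D≈E₂ = pentagonal-number-theorem (x * x) r₂ r₂-inverse N [x*x]ᴺ⁺¹≈0

    O*D≈A : O * D ≈ A
    O*D≈A = trans (eulerOdd*euler N)
      (trans (K.reflexive (cong (euler x) (double N))) (euler-stable N))
      where
      double : ∀ N → N ℕ.* 2 ≡ N ℕ.+ N
      double = ℕSolver.solve-∀

    O*Ψ≈D : O * triangularSum x (suc N) ≈ D
    O*Ψ≈D = begin
      O * triangularSum x (suc N)              ≈⟨ *-congˡ (triangularSum-stable N) ⟨
      O * triangularSum x (N ℕ.+ suc N)        ≈⟨ *-congˡ (K.reflexive (cong (triangularSum x) (double N))) ⟩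
      O * triangularSum x (suc (N ℕ.* 2))      ≈⟨ gauss-triangular x r₂ r₂-inverse N xᴺ⁺¹≈0 ⟩
      D                                        ∎
      where
      double : ∀ N → N ℕ.+ suc N ≡ suc (N ℕ.* 2)
      double = ℕSolver.solve-∀

    D*Φ≈A² : D * Φ ≈ A * A
    D*Φ≈A² = begin
      D * Φ        ≈⟨ *-congʳ (euler*eulerPlus N) ⟨
      A * B * Φ    ≈⟨ *-assoc A B Φ ⟩
      A * (B * Φ)  ≈⟨ *-congˡ (gauss-square x r r-inverse N xᴺ⁺¹≈0) ⟩
      A * A        ∎

    euler-inverse : ℕ → Carrier
    euler-inverse n = ∏ n r₂

    euler-inverse-correct : ∀ n → euler-inverse n * euler (x * x) n ≈ 1#
    euler-inverse-correct zero = *-identityˡ 1#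
    euler-inverse-correct (suc n) = begin
      euler-inverse n * r₂ n * (euler (x * x) n * (1# - (x * x) ^ suc n))
        ≈⟨ solve 4 (λ I r D u → I :* r :* (D :* u) := I :* D :* (r :* u)) K.refl _ (r₂ n) _ _ ⟩
      euler-inverse n * euler (x * x) n * (r₂ n * (1# - (x * x) ^ suc n))
        ≈⟨ *-cong (euler-inverse-correct n) (r₂-inverse n) ⟩
      1# * 1#
        ≈⟨ *-identityˡ 1# ⟩
      1# ∎

    module Modulo4 (4≈0 : (1# + 1#) * (1# + 1#) ≈ 0#) where

      squareSum-odd : ∀ n → Σ Carrier λ g → squareSum x n ≈ 1# + (1# + 1#) * g
      squareSum-odd zero = 0# , (begin
        0# + ⟪ + 1 ⟫ * 1#       ≈⟨ trans (+-identityˡ _) (trans (*-identityʳ _) 1-homo) ⟩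
        1#                      ≈⟨ trans (+-congˡ (zeroʳ _)) (+-identityʳ 1#) ⟨
        1# + (1# + 1#) * 0#     ∎)
      squareSum-odd (suc n) with g , eq ← squareSum-odd n = g + s * X , (begin
        squareSum x n + ⟪ + 2 ℤ.* sign (suc n) ⟫ * X
          ≈⟨ +-cong eq (*-congʳ (*-homo (+ 2) (sign (suc n)))) ⟩
        1# + (1# + 1#) * g + ⟪ + 2 ⟫ * s * X
          ≈⟨ solve 3 (λ g s X → :1 :+ (:1 :+ :1) :* g :+ con (+ 2) :* s :* X := :1 :+ (:1 :+ :1) :* (g :+ s :* X))
               K.refl g s X ⟩
        1# + (1# + 1#) * (g + s * X) ∎)
        where
        s = ⟪ sign (suc n) ⟫
        X = x ^ (suc n ℕ.* suc n)

      Φ²≈1 : Φ * Φ ≈ 1#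
      Φ²≈1 with g , eq ← squareSum-odd N = begin
        Φ * Φ
          ≈⟨ *-cong eq eq ⟩
        (1# + (1# + 1#) * g) * (1# + (1# + 1#) * g)
          ≈⟨ solve 1 (λ g → (:1 :+ (:1 :+ :1) :* g) :* (:1 :+ (:1 :+ :1) :* g)
               := :1 :+ (:1 :+ :1) :* (:1 :+ :1) :* (g :+ g :* g)) K.refl g ⟩
        1# + (1# + 1#) * (1# + 1#) * (g + g * g)
          ≈⟨ +-congˡ (trans (*-congʳ 4≈0) (zeroˡ _)) ⟩
        1# + 0#
          ≈⟨ +-identityʳ 1# ⟩
        1# ∎

      module _ (S : Carrier) (A*S≈Ψ : A * S ≈ triangularSum x (suc N)) where

        -- SΦD = SA² = ΨA = ΨOD = D², so SΦ = D.
        S*Φ≈D : S * Φ ≈ D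
        S*Φ≈D = begin
          S * Φ                          ≈⟨ *-identityˡ _ ⟨
          1# * (S * Φ)                   ≈⟨ *-congʳ inverse ⟨
          I * D * (S * Φ)                ≈⟨ solve 4 (λ I D S P → I :* D :* (S :* P) := I :* (S :* (D :* P))) K.refl I D S Φ ⟩
          I * (S * (D * Φ))              ≈⟨ *-congˡ (*-congˡ D*Φ≈A²) ⟩
          I * (S * (A * A))              ≈⟨ solve 3 (λ I S A → I :* (S :* (A :* A)) := I :* (A :* S :* A)) K.refl I S A ⟩
          I * (A * S * A)                ≈⟨ *-congˡ (*-cong A*S≈Ψ (sym O*D≈A)) ⟩
          I * (Ψ * (O * D))              ≈⟨ solve 4 (λ I P O D → I :* (P :* (O :* D)) := I :* D :* (O :* P)) K.refl I Ψ O D ⟩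
          I * D * (O * Ψ)                ≈⟨ *-cong inverse O*Ψ≈D ⟩
          1# * D                         ≈⟨ *-identityˡ D ⟩
          D                              ∎
          where
          I = euler-inverse N
          Ψ = triangularSum x (suc N)
          inverse = euler-inverse-correct N

        -- Modulo 4 `Φ` is its own inverse, so `S*Φ≈D` is solved for `S` by multiplying with `Φ`.
        S≈D*Φ : S ≈ D * Φ
        S≈D*Φ = begin
          S            ≈⟨ *-identityʳ S ⟨
          S * 1#       ≈⟨ *-congˡ Φ²≈1 ⟨
          S * (Φ * Φ)  ≈⟨ *-assoc S Φ Φ ⟨
          S * Φ * Φ    ≈⟨ *-congʳ S*Φ≈D ⟩
          D * Φ        ∎

        S≈E₂*Φ : S ≈ E₂ * Φ
        S≈E₂*Φ = trans S≈D*Φ (*-congʳ D≈E₂)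

        S≈E*E : S ≈ E * E
        S≈E*E = trans S≈D*Φ (trans D*Φ≈A² (*-cong A≈E A≈E))

-- The mex statistic on partitions with bounded parts

-- Expresses mex π = r + 1 by membership alone, without the scan over `length π`; in this form it
-- can be followed when parts are added.
record HasRun (π : List ℕ) (r : ℕ) : Set where
  constructor run
  field
    run-∈ : ∀ i → i ℕ.< r → suc i ∈ π
    end-∉ : suc r ∉ π
open HasRun

HasRun-unique : ∀ {π r s} → HasRun π r → HasRun π s → r ≡ s
HasRun-unique {r = r} {s} R S with ℕ.<-cmp r s
... | tri< r<s _ _ = ⊥-elim (end-∉ R (run-∈ S r r<s))
... | tri≈ _ r≡s _ = r≡s
... | tri> _ _ s<r = ⊥-elim (end-∉ S (run-∈ R s s<r))

module _ {P : Pred ℕ 0ℓ} (P? : Decidable P) where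

  private
    prefix : (ℕ → ℕ) → ℕ → ℕ
    prefix g L = length (takeWhile P? (applyUpTo g L))

  takeWhile-sound : ∀ g L i → i ℕ.< prefix g L → P (g i)
  takeWhile-sound g (suc L) i i< with P? (g 0)
  takeWhile-sound g (suc L) zero    i<         | yes p = p
  takeWhile-sound g (suc L) (suc i) (ℕ.s≤s i<) | yes p = takeWhile-sound (g ∘ suc) L i i<
  takeWhile-sound g (suc L) i       ()         | no _

  takeWhile-stops : ∀ g L → prefix g L ≢ L → ¬ P (g (prefix g L))
  takeWhile-stops g zero    ≢L = ⊥-elim (≢L refl)
  takeWhile-stops g (suc L) ≢L with P? (g 0)
  ... | yes p = takeWhile-stops (g ∘ suc) L (≢L ∘ cong suc)
  ... | no ¬p = ¬p

-- Pigeonhole: the positions of 1, ..., L + 1 in a list of length L collide, yet a position holds a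
-- single value. This justifies the cutoff of the scan in `mex`.
run-bounded : ∀ π → ¬ (∀ i → i ℕ.< suc (length π) → suc i ∈ π)
run-bounded π all∈ = collision (Fin.pigeonhole (ℕ.n<1+n (length π)) position)
  where
  open ≡.≡-Reasoning
  ∈π : (i : Fin (suc (length π))) → suc (toℕ i) ∈ π
  ∈π i = all∈ (toℕ i) (Fin.toℕ<n i)
  position : Fin (suc (length π)) → Fin (length π)
  position i = Any.index (∈π i)
  collision : ¬ (∃₂ λ i j → i Fin.< j × position i ≡ position j)
  collision (i , j , i<j , eq) = ℕ.<⇒≢ i<j (ℕ.suc-injective (begin
    suc (toℕ i)              ≡⟨ Any.lookup-index (∈π i) ⟩
    lookup π (position i)    ≡⟨ cong (lookup π) eq ⟩
    lookup π (position j)    ≡⟨ Any.lookup-index (∈π j) ⟨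
    suc (toℕ j)              ∎))

mex-run : ∀ π → Σ ℕ λ r → HasRun π r × mex π ≡ suc r
mex-run π = r , run ∈π ∉π , cong (suc ∘ length ∘ takeWhile (_∈? π)) (List.map-upTo suc L)
  where
  L = length π
  r = length (takeWhile (_∈? π) (applyUpTo suc L))
  ∈π : ∀ i → i ℕ.< r → suc i ∈ π
  ∈π = takeWhile-sound (_∈? π) suc L
  ∉π : suc r ∉ π
  ∉π r+1∈π with r ℕ.≟ L
  ... | no r≢L = takeWhile-stops (_∈? π) suc L r≢L r+1∈π
  -- The scan accepted all L candidates; if L + 1 were a part as well, 1, ..., L + 1 would all be
  -- parts.
  ... | yes r≡L = run-bounded π λ i i<L+1 →
    [ ∈π i , (λ { refl → r+1∈π }) ]
      (ℕ.m≤n⇒m<n∨m≡n (ℕ.≤-trans (ℕ.≤-pred i<L+1) (ℕ.≤-reflexive (≡.sym r≡L))))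

mex-unique : ∀ {π r} → HasRun π r → mex π ≡ suc r
mex-unique {π} R with s , S , eq ← mex-run π = ≡.trans eq (cong suc (HasRun-unique S R))

-- For π with parts at most m this marks the partitions containing all of 1, ..., m, the only ones
-- whose mex changes when parts m + 1 are adjoined.
isFull : ℕ → List ℕ → ℕ
isFull m π with mex π ℕ.≟ suc m
... | yes _ = 1
... | no  _ = 0

isFull-yes : ∀ {m π} → mex π ≡ suc m → isFull m π ≡ 1
isFull-yes {m} {π} eq with mex π ℕ.≟ suc m
... | yes _ = refl
... | no ¬p = ⊥-elim (¬p eq)

isFull-no : ∀ {m π} → mex π ≢ suc m → isFull m π ≡ 0
isFull-no {m} {π} ≢ with mex π ℕ.≟ suc m
... | yes p = ⊥-elim (≢ p)
... | no _ = refl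

∉-bounded : ∀ {m π v} → All (ℕ._≤ m) π → m ℕ.< v → v ∉ π
∉-bounded bounds m<v v∈π = ℕ.<⇒≱ m<v (All.lookup bounds v∈π)

HasRun-bounded : ∀ {m π r} → All (ℕ._≤ m) π → HasRun π r → r ℕ.≤ m
HasRun-bounded {m} {r = r} bounds R with r ℕ.≤? m
... | yes r≤m = r≤m
... | no r≰m = ⊥-elim (∉-bounded bounds (ℕ.n<1+n m) (run-∈ R m (ℕ.≰⇒> r≰m)))

isFull-suc-bounded : ∀ {m π} → All (ℕ._≤ m) π → isFull (suc m) π ≡ 0
isFull-suc-bounded {m} {π} bounds with r , R , eq ← mex-run π =
  isFull-no {suc m} {π} λ eq′ →
    ℕ.<⇒≱ (ℕ.n<1+n m) (subst (ℕ._≤ m) (ℕ.suc-injective (≡.trans (≡.sym eq) eq′)) (HasRun-bounded bounds R))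

module _ {m π} (bounds : All (ℕ._≤ m) π) (j : ℕ) where

  private
    π⁺ = replicate (suc j) (suc m) ++ π

    bounds⁺ : All (ℕ._≤ suc m) π⁺
    bounds⁺ = All.++⁺ (All.replicate⁺ (suc j) ℕ.≤-refl) (All.map ℕ.m≤n⇒m≤1+n bounds)

    ∈-π⁺⁻ : ∀ {v} → v ≢ suc m → v ∈ π⁺ → v ∈ π
    ∈-π⁺⁻ {v} v≢ v∈ with ∈-++⁻ (replicate (suc j) (suc m)) v∈
    ... | inj₁ v∈rep = ⊥-elim (v≢ (All.lookup (All.replicate⁺ {P = _≡ suc m} (suc j) refl) v∈rep))
    ... | inj₂ v∈π = v∈π

    extend : ∀ {r} → HasRun π r →
      (r ≡ m × HasRun π⁺ (suc m)) Data.Sum.⊎ (r ≢ m × HasRun π⁺ r)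
    extend {r} R with r ℕ.≟ m
    ... | no r≢m = inj₂ (r≢m , run (λ i i<r → ∈-++⁺ʳ _ (run-∈ R i i<r))
                                  (end-∉ R ∘ ∈-π⁺⁻ (r≢m ∘ ℕ.suc-injective)))
    ... | yes refl = inj₁ (refl , run ∈π⁺ (∉-bounded bounds⁺ (ℕ.n<1+n (suc m))))
      where
      ∈π⁺ : ∀ i → i ℕ.< suc m → suc i ∈ π⁺
      ∈π⁺ i i≤m with ℕ.m≤n⇒m<n∨m≡n (ℕ.≤-pred i≤m)
      ... | inj₁ i<m = ∈-++⁺ʳ (replicate (suc j) (suc m)) (run-∈ R i i<m)
      ... | inj₂ refl = here refl

  -- The new part m + 1 matters only if it fills the first gap, and then the mex moves by exactly
  -- one, since no part exceeds m + 1. How many copies are adjoined makes no difference, so the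
  -- right side is free of `j`.
  mex-extend : mex π⁺ ≡ mex π ℕ.+ isFull m π
  mex-extend with r , R , eq ← mex-run π with extend R
  ... | inj₁ (refl , R⁺) = begin
    mex π⁺                  ≡⟨ mex-unique R⁺ ⟩
    suc (suc m)             ≡⟨ ℕ.+-comm 1 (suc m) ⟩
    suc m ℕ.+ 1             ≡⟨ cong₂ ℕ._+_ eq (isFull-yes {m} {π} eq) ⟨
    mex π ℕ.+ isFull m π    ∎
    where open ≡.≡-Reasoning
  ... | inj₂ (r≢m , R⁺) = begin
    mex π⁺                  ≡⟨ mex-unique R⁺ ⟩
    suc r                   ≡⟨ ℕ.+-identityʳ (suc r) ⟨
    suc r ℕ.+ 0             ≡⟨ cong₂ ℕ._+_ eq (isFull-no {m} {π} (λ eq′ → r≢m (ℕ.suc-injective (≡.trans (≡.sym eq) eq′)))) ⟨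
    mex π ℕ.+ isFull m π    ∎
    where open ≡.≡-Reasoning

  isFull-extend : isFull (suc m) π⁺ ≡ isFull m π
  isFull-extend with r , R , eq ← mex-run π with extend R
  ... | inj₁ (refl , R⁺) = ≡.trans (isFull-yes {suc m} {π⁺} (mex-unique R⁺)) (≡.sym (isFull-yes {m} {π} eq))
  ... | inj₂ (r≢m , R⁺) = ≡.trans
    (isFull-no {suc m} {π⁺} λ eq′ → ℕ.<⇒≢ (ℕ.s≤s (HasRun-bounded bounds R)) (ℕ.suc-injective (≡.trans (≡.sym (mex-unique R⁺)) eq′)))
    (≡.sym (isFull-no {m} {π} λ eq′ → r≢m (ℕ.suc-injective (≡.trans (≡.sym eq) eq′))))

partitionsLE-bounded : ∀ m n → All (All (ℕ._≤ m)) (partitionsLE m n)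
partitionsLE-bounded zero zero = [] ∷ []
partitionsLE-bounded zero (suc n) = []
partitionsLE-bounded (suc m) n = All.concat⁺ (All.map⁺ (All.universal
  (λ j → All.map⁺ (All.map (λ bounds → All.++⁺ (All.replicate⁺ j ℕ.≤-refl) (All.map ℕ.m≤n⇒m≤1+n bounds))
                     (partitionsLE-bounded m (n ℕ.∸ j ℕ.* suc m))))
  (filter (λ j → j ℕ.* suc m ℕ.≤? n) (upTo (suc n)))))

total : (List ℕ → ℕ) → ℕ → ℕ → ℕ
total φ m n = sum (map φ (partitionsLE m n))

total-cong : ∀ {φ ψ m} → (∀ {π} → All (ℕ._≤ m) π → φ π ≡ ψ π) → ∀ n → total φ m n ≡ total ψ m n
total-cong {m = m} φ≗ψ n = cong sum (List.map-cong-local (All.map φ≗ψ (partitionsLE-bounded m n)))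

sum-map-+ : ∀ {A : Set} (φ ψ : A → ℕ) xs → sum (map (λ x → φ x ℕ.+ ψ x) xs) ≡ sum (map φ xs) ℕ.+ sum (map ψ xs)
sum-map-+ φ ψ [] = refl
sum-map-+ φ ψ (x ∷ xs) = begin
  φ x ℕ.+ ψ x ℕ.+ sum (map (λ x → φ x ℕ.+ ψ x) xs)       ≡⟨ cong (φ x ℕ.+ ψ x ℕ.+_) (sum-map-+ φ ψ xs) ⟩
  φ x ℕ.+ ψ x ℕ.+ (sum (map φ xs) ℕ.+ sum (map ψ xs))    ≡⟨ interchange (φ x) (ψ x) _ _ ⟩
  φ x ℕ.+ sum (map φ xs) ℕ.+ (ψ x ℕ.+ sum (map ψ xs))    ∎
  where
  open ≡.≡-Reasoning
  interchange : ∀ a b c d → a ℕ.+ b ℕ.+ (c ℕ.+ d) ≡ a ℕ.+ c ℕ.+ (b ℕ.+ d)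
  interchange = ℕSolver.solve-∀

sum-map-concatMap : ∀ {A B : Set} (φ : B → ℕ) (F : A → List B) xs →
  sum (map φ (concatMap F xs)) ≡ sum (map (λ x → sum (map φ (F x))) xs)
sum-map-concatMap φ F [] = refl
sum-map-concatMap φ F (x ∷ xs) = begin
  sum (map φ (F x ++ concatMap F xs))                 ≡⟨ cong sum (List.map-++ φ (F x) _) ⟩
  sum (map φ (F x) ++ map φ (concatMap F xs))         ≡⟨ sum-++ (map φ (F x)) _ ⟩
  sum (map φ (F x)) ℕ.+ sum (map φ (concatMap F xs))  ≡⟨ cong (sum (map φ (F x)) ℕ.+_) (sum-map-concatMap φ F xs) ⟩
  sum (map φ (F x)) ℕ.+ sum (map (λ x → sum (map φ (F x))) xs) ∎
  where open ≡.≡-Reasoning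

total-0 : ∀ {φ m} → (∀ {π} → All (ℕ._≤ m) π → φ π ≡ 0) → ∀ n → total φ m n ≡ 0
total-0 {φ} {m} φ≗0 n = ≡.trans (total-cong {ψ = λ _ → 0} φ≗0 n) (zeros (partitionsLE m n))
  where
  zeros : ∀ (xs : List (List ℕ)) → sum (map (λ _ → 0) xs) ≡ 0
  zeros [] = refl
  zeros (_ ∷ xs) = zeros xs

filter-map : ∀ {A B : Set} {P : Pred B 0ℓ} {Q : Pred A 0ℓ} (P? : Decidable P) (Q? : Decidable Q) (g : A → B) →
  (∀ x → P (g x) → Q x) → (∀ x → Q x → P (g x)) → ∀ xs → filter P? (map g xs) ≡ map g (filter Q? xs)
filter-map P? Q? g to from [] = refl
filter-map P? Q? g to from (x ∷ xs) with Q? x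
... | yes q = ≡.trans (List.filter-accept P? (from x q)) (cong (g x ∷_) (filter-map P? Q? g to from xs))
... | no ¬q = ≡.trans (List.filter-reject P? (¬q ∘ to x)) (filter-map P? Q? g to from xs)

module _ (m : ℕ) where

  private
    k = suc m

    fits? : ∀ n → Decidable (λ j → j ℕ.* k ℕ.≤ n)
    fits? n j = j ℕ.* k ℕ.≤? n

  multiplicities : ℕ → List ℕ
  multiplicities n = filter (fits? n) (upTo (suc n))

  private
    -- j (m + 1) ≤ n forces j ≤ n.
    multiplicities-range : ∀ n d → filter (fits? n) (upTo (d ℕ.+ suc n)) ≡ multiplicities n
    multiplicities-range n zero = refl
    multiplicities-range n (suc d) = begin
      filter (fits? n) (upTo (suc (d ℕ.+ suc n)))
        ≡⟨ cong (filter (fits? n)) (List.upTo-∷ʳ (d ℕ.+ suc n)) ⟨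
      filter (fits? n) (upTo (d ℕ.+ suc n) ++ (d ℕ.+ suc n) ∷ [])
        ≡⟨ List.filter-++ (fits? n) (upTo (d ℕ.+ suc n)) _ ⟩
      filter (fits? n) (upTo (d ℕ.+ suc n)) ++ filter (fits? n) ((d ℕ.+ suc n) ∷ [])
        ≡⟨ cong₂ _++_ (multiplicities-range n d) (List.filter-reject (fits? n) {d ℕ.+ suc n} {[]} too-big) ⟩
      multiplicities n ++ []
        ≡⟨ List.++-identityʳ _ ⟩
      multiplicities n ∎
      where
      open ≡.≡-Reasoning
      too-big : ¬ ((d ℕ.+ suc n) ℕ.* k ℕ.≤ n)
      too-big le = ℕ.<⇒≱ (ℕ.≤-trans (ℕ.m≤n+m (suc n) d) (ℕ.m≤m*n (d ℕ.+ suc n) k)) le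

    multiplicities-∷ : ∀ n → multiplicities n ≡ 0 ∷ filter (fits? n) (map suc (upTo n))
    multiplicities-∷ n = cong (λ xs → 0 ∷ filter (fits? n) xs) (≡.sym (List.map-upTo suc n))

    multiplicities-+ : ∀ n → multiplicities (k ℕ.+ n) ≡ 0 ∷ map suc (multiplicities n)
    multiplicities-+ n = begin
      multiplicities (k ℕ.+ n)
        ≡⟨ multiplicities-∷ (k ℕ.+ n) ⟩
      0 ∷ filter (fits? (k ℕ.+ n)) (map suc (upTo (k ℕ.+ n)))
        ≡⟨ cong (0 ∷_) (filter-map (fits? (k ℕ.+ n)) (fits? n) suc
             (λ _ → ℕ.+-cancelˡ-≤ k _ _) (λ _ → ℕ.+-monoʳ-≤ k) (upTo (k ℕ.+ n))) ⟩
      0 ∷ map suc (filter (fits? n) (upTo (k ℕ.+ n)))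
        ≡⟨ cong (λ l → 0 ∷ map suc (filter (fits? n) (upTo l))) (≡.sym (ℕ.+-suc m n)) ⟩
      0 ∷ map suc (filter (fits? n) (upTo (m ℕ.+ suc n)))
        ≡⟨ cong (λ xs → 0 ∷ map suc xs) (multiplicities-range n m) ⟩
      0 ∷ map suc (multiplicities n) ∎
      where open ≡.≡-Reasoning

    multiplicities-small : ∀ n → n ℕ.< k → multiplicities n ≡ 0 ∷ []
    multiplicities-small n n<k = ≡.trans (multiplicities-∷ n) (cong (0 ∷_) (none (upTo n)))
      where
      none : ∀ xs → filter (fits? n) (map suc xs) ≡ []
      none [] = refl
      none (j ∷ xs) = ≡.trans
        (List.filter-reject (fits? n) {suc j} (ℕ.<⇒≱ (ℕ.<-≤-trans n<k (ℕ.m≤m+n k (j ℕ.* k))))) (none xs)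

    total-suc : ∀ φ n → total φ k n ≡
      sum (map (λ j → total (λ π → φ (replicate j k ++ π)) m (n ℕ.∸ j ℕ.* k)) (multiplicities n))
    total-suc φ n = ≡.trans (sum-map-concatMap φ
        (λ j → map (replicate j k ++_) (partitionsLE m (n ℕ.∸ j ℕ.* k))) (multiplicities n))
      (cong sum (List.map-cong (λ j → cong sum (≡.sym (List.map-∘ {g = φ} {f = replicate j k ++_} (partitionsLE m (n ℕ.∸ j ℕ.* k)))))
        (multiplicities n)))

  total-small : ∀ φ n → n ℕ.< k → total φ k n ≡ total φ m n
  total-small φ n n<k = ≡.trans (total-suc φ n)
    (≡.trans (cong (λ xs → sum (map (λ j → total (λ π → φ (replicate j k ++ π)) m (n ℕ.∸ j ℕ.* k)) xs))
               (multiplicities-small n n<k)) (ℕ.+-identityʳ _))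

  -- Split by the multiplicity of k: passing from n to k + n shifts it by one, and every positive
  -- multiplicity contributes ψ of the remaining parts. For the generating functions this is (1 -
  -- q^k)(Φ_k - Φ_m) = q^k Ψ_m, rearranged so that no subtraction in ℕ occurs.
  total-recurrence : ∀ φ ψ → (∀ {π} → All (ℕ._≤ m) π → ∀ j → φ (replicate (suc j) k ++ π) ≡ ψ π) →
    ∀ n → total φ k (k ℕ.+ n) ℕ.+ total φ m n ≡ total φ m (k ℕ.+ n) ℕ.+ (total φ k n ℕ.+ total ψ m n)
  total-recurrence φ ψ φ⁺≗ψ n = begin
    total φ k (k ℕ.+ n) ℕ.+ total φ m n
      ≡⟨ cong (ℕ._+ total φ m n) (total-suc φ (k ℕ.+ n)) ⟩
    sum (map (term (k ℕ.+ n)) (multiplicities (k ℕ.+ n))) ℕ.+ total φ m n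
      ≡⟨ cong (λ xs → sum (map (term (k ℕ.+ n)) xs) ℕ.+ total φ m n) (multiplicities-+ n) ⟩
    total φ m (k ℕ.+ n) ℕ.+ sum (map (term (k ℕ.+ n)) (map suc (multiplicities n))) ℕ.+ total φ m n
      ≡⟨ cong (λ s → total φ m (k ℕ.+ n) ℕ.+ s ℕ.+ total φ m n) (sum-suc (k ℕ.+ n) (multiplicities n)) ⟩
    total φ m (k ℕ.+ n) ℕ.+ sum (map (termψ (k ℕ.+ n) ∘ suc) (multiplicities n)) ℕ.+ total φ m n
      ≡⟨ cong (λ s → total φ m (k ℕ.+ n) ℕ.+ s ℕ.+ total φ m n)
           (cong sum (List.map-cong (λ j → cong (total ψ m) (ℕ.[m+n]∸[m+o]≡n∸o k n (j ℕ.* k))) (multiplicities n))) ⟩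
    total φ m (k ℕ.+ n) ℕ.+ sum (map (termψ n) (multiplicities n)) ℕ.+ total φ m n
      ≡⟨ cong (λ s → total φ m (k ℕ.+ n) ℕ.+ s ℕ.+ total φ m n) split ⟩
    total φ m (k ℕ.+ n) ℕ.+ (total ψ m n ℕ.+ tail) ℕ.+ total φ m n
      ≡⟨ rearrange (total φ m (k ℕ.+ n)) (total ψ m n) tail (total φ m n) ⟩
    total φ m (k ℕ.+ n) ℕ.+ ((total φ m n ℕ.+ tail) ℕ.+ total ψ m n)
      ≡⟨ cong (λ s → total φ m (k ℕ.+ n) ℕ.+ (s ℕ.+ total ψ m n)) whole ⟨
    total φ m (k ℕ.+ n) ℕ.+ (total φ k n ℕ.+ total ψ m n) ∎
    where
    open ≡.≡-Reasoning
    term : ℕ → ℕ → ℕ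
    term n j = total (λ π → φ (replicate j k ++ π)) m (n ℕ.∸ j ℕ.* k)
    termψ : ℕ → ℕ → ℕ
    termψ n j = total ψ m (n ℕ.∸ j ℕ.* k)
    sum-suc : ∀ n xs → sum (map (term n) (map suc xs)) ≡ sum (map (termψ n ∘ suc) xs)
    sum-suc n xs = cong sum (≡.trans (≡.sym (List.map-∘ xs))
      (List.map-cong (λ j → total-cong (λ bounds → φ⁺≗ψ bounds j) (n ℕ.∸ suc j ℕ.* k)) xs))
    positive : List ℕ
    positive = filter (λ j → fits? n (suc j)) (upTo n)
    multiplicities≡ : multiplicities n ≡ 0 ∷ map suc positive
    multiplicities≡ = ≡.trans (multiplicities-∷ n) (cong (0 ∷_)
      (filter-map (fits? n) (λ j → fits? n (suc j)) suc (λ _ → id) (λ _ → id) (upTo n)))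
    tail : ℕ
    tail = sum (map (termψ n ∘ suc) positive)
    split : sum (map (termψ n) (multiplicities n)) ≡ total ψ m n ℕ.+ tail
    split = ≡.trans (cong (λ xs → sum (map (termψ n) xs)) multiplicities≡)
      (cong (λ xs → total ψ m n ℕ.+ sum xs) (≡.sym (List.map-∘ positive)))
    whole : total φ k n ≡ total φ m n ℕ.+ tail
    whole = ≡.trans (total-suc φ n) (≡.trans (cong (λ xs → sum (map (term n) xs)) multiplicities≡)
      (cong (total φ m n ℕ.+_) (sum-suc n positive)))
    rearrange : ∀ a b c d → a ℕ.+ (b ℕ.+ c) ℕ.+ d ≡ a ℕ.+ ((d ℕ.+ c) ℕ.+ b)
    rearrange = ℕSolver.solve-∀

-- Truncated power series modulo m

module Congruence (m : ℤ) where

  infix 4 _≋_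
  record _≋_ (a b : ℤ) : Set where
    constructor congruent
    field divisible : m ℤ.∣ a ℤ.- b
  open _≋_ public

  ≋-reflexive : ∀ {a b} → a ≡ b → a ≋ b
  ≋-reflexive {a} refl = congruent (ℤ.divides (+ 0) (≡.trans (ℤ.+-inverseʳ a) (≡.sym (ℤ.*-zeroˡ m))))

  ≋-sym : ∀ {a b} → a ≋ b → b ≋ a
  ≋-sym {a} {b} (congruent d) = congruent (subst (m ℤ.∣_) (flip a b) (ℤ.∣m⇒∣-m d))
    where
    flip : ∀ a b → ℤ.- (a ℤ.- b) ≡ b ℤ.- a
    flip = ℤSolver.solve-∀

  ≋-trans : ∀ {a b c} → a ≋ b → b ≋ c → a ≋ c
  ≋-trans {a} {b} {c} (congruent d) (congruent e) = congruent (subst (m ℤ.∣_) (join a b c) (ℤ.∣m∣n⇒∣m+n d e))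
    where
    join : ∀ a b c → (a ℤ.- b) ℤ.+ (b ℤ.- c) ≡ a ℤ.- c
    join = ℤSolver.solve-∀

  ≋-+ : ∀ {a b c d} → a ≋ b → c ≋ d → a ℤ.+ c ≋ b ℤ.+ d
  ≋-+ {a} {b} {c} {d} (congruent p) (congruent q) = congruent (subst (m ℤ.∣_) (join a b c d) (ℤ.∣m∣n⇒∣m+n p q))
    where
    join : ∀ a b c d → (a ℤ.- b) ℤ.+ (c ℤ.- d) ≡ (a ℤ.+ c) ℤ.- (b ℤ.+ d)
    join = ℤSolver.solve-∀

  ≋-* : ∀ {a b c d} → a ≋ b → c ≋ d → a ℤ.* c ≋ b ℤ.* d
  ≋-* {a} {b} {c} {d} (congruent p) (congruent q) =
    congruent (subst (m ℤ.∣_) (join a b c d) (ℤ.∣m∣n⇒∣m+n (ℤ.∣m⇒∣m*n c p) (ℤ.∣n⇒∣m*n b q)))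
    where
    join : ∀ a b c d → (a ℤ.- b) ℤ.* c ℤ.+ b ℤ.* (c ℤ.- d) ≡ a ℤ.* c ℤ.- b ℤ.* d
    join = ℤSolver.solve-∀

  ≋-neg : ∀ {a b} → a ≋ b → ℤ.- a ≋ ℤ.- b
  ≋-neg {a} {b} (congruent d) = congruent (subst (m ℤ.∣_) (push a b) (ℤ.∣m⇒∣-m d))
    where
    push : ∀ a b → ℤ.- (a ℤ.- b) ≡ ℤ.- a ℤ.- ℤ.- b
    push = ℤSolver.solve-∀

Series : Set
Series = ℕ → ℤ

infixl 6 _⊕_
infixl 7 _⊛_
_⊕_ _⊛_ : Series → Series → Series
(f ⊕ g) n = f n ℤ.+ g n
(f ⊛ g) zero    = f 0 ℤ.* g 0
(f ⊛ g) (suc n) = f 0 ℤ.* g (suc n) ℤ.+ ((f ∘ suc) ⊛ g) n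

⊝_ : Series → Series
(⊝ f) n = ℤ.- f n

const : ℤ → Series
const c zero    = c
const c (suc n) = + 0

-- The monomial q^e. Evaluated at n it is the Kronecker delta, which is how `weight` later selects
-- the solutions of an equation.
δ : ℕ → Series
δ zero    = const (+ 1)
δ (suc e) zero    = + 0
δ (suc e) (suc n) = δ e n

⊛-zeroˡ : ∀ g n → ((λ _ → + 0) ⊛ g) n ≡ + 0
⊛-zeroˡ g zero = refl
⊛-zeroˡ g (suc n) = ≡.trans (ℤ.+-identityˡ _) (⊛-zeroˡ g n)

const-⊛ : ∀ c g n → (const c ⊛ g) n ≡ c ℤ.* g n
const-⊛ c g zero = refl
const-⊛ c g (suc n) = ≡.trans (cong (λ w → c ℤ.* g (suc n) ℤ.+ w) (⊛-zeroˡ g n)) (ℤ.+-identityʳ _)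

⊛-distribʳ : ∀ h f g n → ((f ⊕ g) ⊛ h) n ≡ (f ⊛ h ⊕ g ⊛ h) n
⊛-distribʳ h f g zero = ℤ.*-distribʳ-+ (h 0) (f 0) (g 0)
⊛-distribʳ h f g (suc n) = ≡.trans (cong (λ w → (f 0 ℤ.+ g 0) ℤ.* h (suc n) ℤ.+ w) (⊛-distribʳ h (f ∘ suc) (g ∘ suc) n))
  (rearrange (f 0) (g 0) (h (suc n)) _ _)
  where
  rearrange : ∀ a b c d e → (a ℤ.+ b) ℤ.* c ℤ.+ (d ℤ.+ e) ≡ (a ℤ.* c ℤ.+ d) ℤ.+ (b ℤ.* c ℤ.+ e)
  rearrange = ℤSolver.solve-∀

⊛-scale : ∀ c f g n → ((λ i → c ℤ.* f i) ⊛ g) n ≡ c ℤ.* (f ⊛ g) n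
⊛-scale c f g zero = ℤ.*-assoc c (f 0) (g 0)
⊛-scale c f g (suc n) = ≡.trans (cong (λ w → c ℤ.* f 0 ℤ.* g (suc n) ℤ.+ w) (⊛-scale c (f ∘ suc) g n))
  (rearrange c (f 0) (g (suc n)) _)
  where
  rearrange : ∀ c a b d → c ℤ.* a ℤ.* b ℤ.+ c ℤ.* d ≡ c ℤ.* (a ℤ.* b ℤ.+ d)
  rearrange = ℤSolver.solve-∀

⊛-assoc : ∀ f g h n → ((f ⊛ g) ⊛ h) n ≡ (f ⊛ (g ⊛ h)) n
⊛-assoc f g h zero = ℤ.*-assoc (f 0) (g 0) (h 0)
⊛-assoc f g h (suc n) = begin
  f 0 ℤ.* g 0 ℤ.* h (suc n) ℤ.+ (((λ i → f 0 ℤ.* g (suc i)) ⊕ f ∘ suc ⊛ g) ⊛ h) n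
    ≡⟨ cong (λ w → f 0 ℤ.* g 0 ℤ.* h (suc n) ℤ.+ w) (⊛-distribʳ h (λ i → f 0 ℤ.* g (suc i)) (f ∘ suc ⊛ g) n) ⟩
  f 0 ℤ.* g 0 ℤ.* h (suc n) ℤ.+ (((λ i → f 0 ℤ.* g (suc i)) ⊛ h) n ℤ.+ ((f ∘ suc ⊛ g) ⊛ h) n)
    ≡⟨ cong₂ (λ u v → f 0 ℤ.* g 0 ℤ.* h (suc n) ℤ.+ (u ℤ.+ v)) (⊛-scale (f 0) (g ∘ suc) h n) (⊛-assoc (f ∘ suc) g h n) ⟩
  f 0 ℤ.* g 0 ℤ.* h (suc n) ℤ.+ (f 0 ℤ.* (g ∘ suc ⊛ h) n ℤ.+ (f ∘ suc ⊛ (g ⊛ h)) n)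
    ≡⟨ rearrange (f 0) (g 0) (h (suc n)) _ _ ⟩
  f 0 ℤ.* (g 0 ℤ.* h (suc n) ℤ.+ (g ∘ suc ⊛ h) n) ℤ.+ (f ∘ suc ⊛ (g ⊛ h)) n ∎
  where
  open ≡.≡-Reasoning
  rearrange : ∀ a b c d e → a ℤ.* b ℤ.* c ℤ.+ (a ℤ.* d ℤ.+ e) ≡ a ℤ.* (b ℤ.* c ℤ.+ d) ℤ.+ e
  rearrange = ℤSolver.solve-∀

⊛-sucʳ : ∀ f g n → (f ⊛ g) (suc n) ≡ f (suc n) ℤ.* g 0 ℤ.+ (f ⊛ g ∘ suc) n
⊛-sucʳ f g zero = ℤ.+-comm (f 0 ℤ.* g 1) (f 1 ℤ.* g 0)
⊛-sucʳ f g (suc n) = ≡.trans (cong (λ w → f 0 ℤ.* g (suc (suc n)) ℤ.+ w) (⊛-sucʳ (f ∘ suc) g n))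
  (rearrange (f 0 ℤ.* g (suc (suc n))) (f (suc (suc n)) ℤ.* g 0) ((f ∘ suc ⊛ g ∘ suc) n))
  where
  rearrange : ∀ a b c → a ℤ.+ (b ℤ.+ c) ≡ b ℤ.+ (a ℤ.+ c)
  rearrange = ℤSolver.solve-∀

⊛-comm : ∀ f g n → (f ⊛ g) n ≡ (g ⊛ f) n
⊛-comm f g zero = ℤ.*-comm (f 0) (g 0)
⊛-comm f g (suc n) = ≡.trans (cong₂ ℤ._+_ (ℤ.*-comm (f 0) (g (suc n))) (⊛-comm (f ∘ suc) g n)) (≡.sym (⊛-sucʳ g f n))

δ-⊛-+ : ∀ k f n → (δ k ⊛ f) (k ℕ.+ n) ≡ f n
δ-⊛-+ zero    f n = ≡.trans (const-⊛ (+ 1) f n) (ℤ.*-identityˡ (f n))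
δ-⊛-+ (suc k) f n = ≡.trans (ℤ.+-identityˡ _) (δ-⊛-+ k f n)

δ-⊛-< : ∀ k f n → n ℕ.< k → (δ k ⊛ f) n ≡ + 0
δ-⊛-< (suc k) f zero    n<k         = refl
δ-⊛-< (suc k) f (suc n) (ℕ.s≤s n<k) = ≡.trans (ℤ.+-identityˡ _) (δ-⊛-< k f n n<k)

δ-⊛-δ : ∀ k e n → (δ k ⊛ δ e) n ≡ δ (k ℕ.+ e) n
δ-⊛-δ zero    e n       = ≡.trans (const-⊛ (+ 1) (δ e) n) (ℤ.*-identityˡ _)
δ-⊛-δ (suc k) e zero    = refl
δ-⊛-δ (suc k) e (suc n) = ≡.trans (ℤ.+-identityˡ _) (δ-⊛-δ k e n)

δ-refl : ∀ e → δ e e ≡ + 1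
δ-refl zero = refl
δ-refl (suc e) = δ-refl e

δ-≢ : ∀ e n → e ≢ n → δ e n ≡ + 0
δ-≢ zero    zero    e≢n = ⊥-elim (e≢n refl)
δ-≢ zero    (suc n) e≢n = refl
δ-≢ (suc e) zero    e≢n = refl
δ-≢ (suc e) (suc n) e≢n = δ-≢ e n (e≢n ∘ cong suc)

module TruncatedSeries (m : ℤ) (N : ℕ) where
  open Congruence m

  infix 4 _~_
  -- Series are never cut off; only their equality is coarsened, so that the quotient by m and
  -- q^{N+1} appears as a setoid on all series.
  record _~_ (f g : Series) : Set where
    constructor agree
    field coefficient : ∀ n → n ℕ.≤ N → f n ≋ g n
  open _~_ public

  ≗⇒~ : ∀ {f g} → (∀ n → f n ≡ g n) → f ~ g
  ≗⇒~ f≗g = agree λ n _ → ≋-reflexive (f≗g n)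

  private
    ⊛-cong-≤ : ∀ {f f′ g g′} n → (∀ i → i ℕ.≤ n → f i ≋ f′ i) → (∀ i → i ℕ.≤ n → g i ≋ g′ i) →
      (f ⊛ g) n ≋ (f′ ⊛ g′) n
    ⊛-cong-≤ zero f~ g~ = ≋-* (f~ 0 ℕ.z≤n) (g~ 0 ℕ.z≤n)
    ⊛-cong-≤ (suc n) f~ g~ = ≋-+ (≋-* (f~ 0 ℕ.z≤n) (g~ (suc n) ℕ.≤-refl))
      (⊛-cong-≤ n (λ i i≤n → f~ (suc i) (ℕ.s≤s i≤n)) (λ i i≤n → g~ i (ℕ.m≤n⇒m≤1+n i≤n)))

  ⊛-cong : ∀ {f f′ g g′} → f ~ f′ → g ~ g′ → f ⊛ g ~ f′ ⊛ g′
  ⊛-cong (agree f~) (agree g~) = agree λ n n≤N →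
    ⊛-cong-≤ n (λ i i≤n → f~ i (ℕ.≤-trans i≤n n≤N)) (λ i i≤n → g~ i (ℕ.≤-trans i≤n n≤N))

  ~-isEquivalence : IsEquivalence _~_
  ~-isEquivalence = record
    { refl  = agree λ _ _ → ≋-reflexive refl
    ; sym   = λ (agree p) → agree λ n n≤N → ≋-sym (p n n≤N)
    ; trans = λ (agree p) (agree q) → agree λ n n≤N → ≋-trans (p n n≤N) (q n n≤N)
    }

  seriesRing : CommutativeRing 0ℓ 0ℓ
  seriesRing = record
    { Carrier = Series
    ; _≈_ = _~_
    ; _+_ = _⊕_
    ; _*_ = _⊛_
    ; -_  = ⊝_
    ; 0#  = λ _ → + 0
    ; 1#  = const (+ 1)
    ; isCommutativeRing = record
      { isRing = record
        { +-isAbelianGroup = record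
          { isGroup = record
            { isMonoid = record
              { isSemigroup = record
                { isMagma = record
                  { isEquivalence = ~-isEquivalence
                  ; ∙-cong = λ (agree p) (agree q) → agree λ n n≤N → ≋-+ (p n n≤N) (q n n≤N)
                  }
                ; assoc = λ f g h → ≗⇒~ λ n → ℤ.+-assoc (f n) (g n) (h n)
                }
              ; identity = (λ f → ≗⇒~ λ n → ℤ.+-identityˡ (f n)) , (λ f → ≗⇒~ λ n → ℤ.+-identityʳ (f n))
              }
            ; inverse = (λ f → ≗⇒~ λ n → ℤ.+-inverseˡ (f n)) , (λ f → ≗⇒~ λ n → ℤ.+-inverseʳ (f n))
            ; ⁻¹-cong = λ (agree p) → agree λ n n≤N → ≋-neg (p n n≤N)
            }
          ; comm = λ f g → ≗⇒~ λ n → ℤ.+-comm (f n) (g n)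
          }
        ; *-cong = ⊛-cong
        ; *-assoc = λ f g h → ≗⇒~ (⊛-assoc f g h)
        ; *-identity = (λ f → ≗⇒~ (identityˡ f)) , (λ f → ≗⇒~ λ n → ≡.trans (⊛-comm f (const (+ 1)) n) (identityˡ f n))
        ; distrib = (λ f g h → ≗⇒~ (distribˡ f g h)) , (λ h f g → ≗⇒~ (⊛-distribʳ h f g))
        }
      ; *-comm = λ f g → ≗⇒~ (⊛-comm f g)
      }
    }
    where
    identityˡ : ∀ f n → (const (+ 1) ⊛ f) n ≡ f n
    identityˡ f n = ≡.trans (const-⊛ (+ 1) f n) (ℤ.*-identityˡ (f n))
    distribˡ : ∀ f g h n → (f ⊛ (g ⊕ h)) n ≡ (f ⊛ g ⊕ f ⊛ h) n
    distribˡ f g h n = ≡.trans (⊛-comm f (g ⊕ h) n)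
      (≡.trans (⊛-distribʳ f g h n) (cong₂ ℤ._+_ (⊛-comm g f n) (⊛-comm h f n)))

  constants : +-*-rawRing -Raw-AlmostCommutative⟶ fromCommutativeRing seriesRing
  constants = record
    { ⟦_⟧    = const
    ; +-homo = λ a b → ≗⇒~ λ { zero → refl ; (suc n) → refl }
    ; *-homo = λ a b → ≗⇒~ λ n → ≡.trans (scale a b n) (≡.sym (const-⊛ a (const b) n))
    ; -‿homo = λ a → ≗⇒~ λ { zero → refl ; (suc n) → refl }
    ; 0-homo = ≗⇒~ λ { zero → refl ; (suc n) → refl }
    ; 1-homo = ≗⇒~ λ _ → refl
    }
    where
    scale : ∀ a b n → const (a ℤ.* b) n ≡ a ℤ.* const b n
    scale a b zero = refl
    scale a b (suc n) = ≡.sym (ℤ.*-zeroʳ a)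

open Summation ℤ.+-*-commutativeRing using () renaming (∑ to ∑ℤ)

totalSeries : (List ℕ → ℕ) → ℕ → Series
totalSeries φ m n = + total φ m n

totalSeries-recurrence : ∀ m φ ψ →
  (∀ {π} → All (ℕ._≤ m) π → ∀ j → φ (replicate (suc j) (suc m) ++ π) ≡ ψ π) →
  ∀ n → (totalSeries φ (suc m) ⊕ δ (suc m) ⊛ totalSeries φ m) n
      ≡ (totalSeries φ m ⊕ δ (suc m) ⊛ (totalSeries φ (suc m) ⊕ totalSeries ψ m)) n
totalSeries-recurrence m φ ψ φ⁺≗ψ n with suc m ℕ.≤? n
... | no m≮n = cong₂ ℤ._+_ (cong +_ (total-small m φ n n<k))
    (≡.trans (δ-⊛-< (suc m) _ n n<k) (≡.sym (δ-⊛-< (suc m) _ n n<k)))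
  where n<k = ℕ.≰⇒> m≮n
... | yes k≤n = subst (λ n → (new ⊕ δ (suc m) ⊛ old) n ≡ (old ⊕ δ (suc m) ⊛ (new ⊕ added)) n) (ℕ.m+[n∸m]≡n k≤n) (begin
    new (suc m ℕ.+ n′) ℤ.+ (δ (suc m) ⊛ old) (suc m ℕ.+ n′)
      ≡⟨ cong (λ w → new (suc m ℕ.+ n′) ℤ.+ w) (δ-⊛-+ (suc m) old n′) ⟩
    new (suc m ℕ.+ n′) ℤ.+ old n′
      ≡⟨ cong +_ (total-recurrence m φ ψ φ⁺≗ψ n′) ⟩
    old (suc m ℕ.+ n′) ℤ.+ (new ⊕ added) n′
      ≡⟨ cong (λ w → old (suc m ℕ.+ n′) ℤ.+ w) (δ-⊛-+ (suc m) (new ⊕ added) n′) ⟨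
    old (suc m ℕ.+ n′) ℤ.+ (δ (suc m) ⊛ (new ⊕ added)) (suc m ℕ.+ n′) ∎)
  where
  open ≡.≡-Reasoning
  n′ = n ℕ.∸ suc m
  new = totalSeries φ (suc m)
  old = totalSeries φ m
  added = totalSeries ψ m

-- The generating function of `σmex` modulo 4

module GeneratingFunction (N : ℕ) where
  open Congruence (+ 4)
  open TruncatedSeries (+ 4) N
  open CommutativeRing seriesRing hiding (zero; refl; _≈_)
  private module K = CommutativeRing seriesRing
  open Algebra.Properties.CommutativeSemiring.Exp commutativeSemiring
  open Relation.Binary.Reasoning.Setoid setoid
  open ThetaIdentities seriesRing constants
  open Summation seriesRing

  X : Series
  X = δ 1

  X^ : ∀ k → X ^ k ~ δ k
  X^ zero = K.refl
  X^ (suc k) = trans (*-congˡ (X^ k)) (≗⇒~ (δ-⊛-δ 1 k))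

  T F : ℕ → Series
  T = totalSeries mex
  F m = totalSeries (isFull m) m

  T-step : ∀ m → T (suc m) + X ^ suc m * T m ~ T m + X ^ suc m * (T (suc m) + (T m + F m))
  T-step m = begin
    T (suc m) + X ^ suc m * T m
      ≈⟨ +-congˡ {T (suc m)} (*-congʳ {T m} (X^ (suc m))) ⟩
    T (suc m) + δ (suc m) * T m
      ≈⟨ ≗⇒~ (totalSeries-recurrence m mex (λ π → mex π ℕ.+ isFull m π) mex-extend) ⟩
    T m + δ (suc m) * (T (suc m) + totalSeries (λ π → mex π ℕ.+ isFull m π) m)
      ≈⟨ +-congˡ {T m} (*-congˡ {δ (suc m)} (+-congˡ {T (suc m)} (≗⇒~ λ n → cong +_ (sum-map-+ mex (isFull m) (partitionsLE m n))))) ⟩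
    T m + δ (suc m) * (T (suc m) + (T m + F m))
      ≈⟨ +-congˡ {T m} (*-congʳ {T (suc m) + (T m + F m)} (X^ (suc m))) ⟨
    T m + X ^ suc m * (T (suc m) + (T m + F m)) ∎

  -- With parts at most m the mex cannot reach m + 2, so `F⁰` vanishes and two of the terms of the
  -- general recurrence drop out.
  F-step : ∀ m → F (suc m) ~ X ^ suc m * (F (suc m) + F m)
  F-step m = begin
    F (suc m)
      ≈⟨ +-identityʳ _ ⟨
    F (suc m) + 0#
      ≈⟨ +-congˡ {F (suc m)} (trans (*-congˡ {δ (suc m)} F⁰≈0) (zeroʳ (δ (suc m)))) ⟨
    F (suc m) + δ (suc m) * F⁰
      ≈⟨ ≗⇒~ (totalSeries-recurrence m (isFull (suc m)) (isFull m) isFull-extend) ⟩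
    F⁰ + δ (suc m) * (F (suc m) + F m)
      ≈⟨ trans (+-congʳ {δ (suc m) * (F (suc m) + F m)} F⁰≈0) (+-identityˡ _) ⟩
    δ (suc m) * (F (suc m) + F m)
      ≈⟨ *-congʳ {F (suc m) + F m} (X^ (suc m)) ⟨
    X ^ suc m * (F (suc m) + F m) ∎
    where
    F⁰ = totalSeries (isFull (suc m)) m
    F⁰≈0 : F⁰ ~ 0#
    F⁰≈0 = ≗⇒~ λ n → cong +_ (total-0 {isFull (suc m)} {m} isFull-suc-bounded n)

  T₀≈1 : T 0 ~ 1#
  T₀≈1 = ≗⇒~ λ { zero → refl ; (suc n) → refl }

  F₀≈1 : F 0 ~ 1#
  F₀≈1 = ≗⇒~ λ { zero → refl ; (suc n) → refl }

  Xᴺ⁺¹≈0 : X ^ suc N ~ 0#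
  Xᴺ⁺¹≈0 = trans (X^ (suc N)) (agree λ n n≤N → ≋-reflexive (δ-≢ (suc N) n (ℕ.>⇒≢ (ℕ.s≤s n≤N))))

  4≈0 : (1# + 1#) * (1# + 1#) ~ 0#
  4≈0 = begin
    (1# + 1#) * (1# + 1#)         ≈⟨ *-cong (+-homo (+ 1) (+ 1)) (+-homo (+ 1) (+ 1)) ⟨
    const (+ 2) * const (+ 2)     ≈⟨ *-homo (+ 2) (+ 2) ⟨
    const (+ 4)                   ≈⟨ agree (λ { zero _ → congruent (ℤ.divides (+ 1) refl) ; (suc n) _ → ≋-reflexive refl }) ⟩
    0#                            ∎
    where open _-Raw-AlmostCommutative⟶_ constants using (+-homo; *-homo)

  open Truncated X N Xᴺ⁺¹≈0 using (E; E₂; Φ; module Modulo4)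
  open Modulo4 4≈0 using (S≈E*E; S≈E₂*Φ)

  ∑-coefficient : ∀ n t i → ∑ n t i ≡ ∑ℤ n (λ k → t k i)
  ∑-coefficient zero    t i = refl
  ∑-coefficient (suc n) t i = cong (λ w → w ℤ.+ t n i) (∑-coefficient n t i)

  monomial-sums : ∀ a b (c d : ℕ → ℤ) (e g : ℕ → ℕ) (s t : ℕ → Series) →
    (∀ i → s i ~ const (c i) * δ (e i)) → (∀ j → t j ~ const (d j) * δ (g j)) →
    (∑ a s * ∑ b t) N ≋ ∑ℤ a (λ i → ∑ℤ b (λ j → c i ℤ.* d j ℤ.* δ (e i ℕ.+ g j) N))
  monomial-sums a b c d e g s t s~ t~ = ≋-trans
    (coefficient (trans (∑*∑ a b s t) (∑-cong a λ i → ∑-cong b λ j → product i j)) N ℕ.≤-refl)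
    (≋-reflexive (≡.trans (∑-coefficient a _ N) (Summation.∑-cong ℤ.+-*-commutativeRing a λ i → ∑-coefficient b _ N)))
    where
    product : ∀ i j → s i * t j ~ (λ n → c i ℤ.* d j ℤ.* δ (e i ℕ.+ g j) n)
    product i j = begin
      s i * t j
        ≈⟨ *-cong (s~ i) (t~ j) ⟩
      const (c i) * δ (e i) * (const (d j) * δ (g j))
        ≈⟨ interchange (const (c i)) (δ (e i)) (const (d j)) (δ (g j)) ⟩
      const (c i) * (const (d j) * (δ (e i) * δ (g j)))
        ≈⟨ *-congˡ (*-congˡ (≗⇒~ (δ-⊛-δ (e i) (g j)))) ⟩
      const (c i) * (const (d j) * δ (e i ℕ.+ g j))
        ≈⟨ ≗⇒~ (λ n → ≡.trans (const-⊛ (c i) _ n) (≡.trans (cong (λ w → c i ℤ.* w) (const-⊛ (d j) _ n)) (≡.sym (ℤ.*-assoc (c i) (d j) _)))) ⟩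
      (λ n → c i ℤ.* d j ℤ.* δ (e i ℕ.+ g j) n) ∎
      where
      interchange : ∀ u v w z → u * v * (w * z) ~ u * (w * (v * z))
      interchange u v w z = trans (*-assoc u v _) (*-congˡ (trans (sym (*-assoc v w z)) (trans (*-congʳ (*-comm v w)) (*-assoc w v z))))

  private
    A*S≈Ψ = euler*T X T F T₀≈1 F₀≈1 T-step F-step N

  σmex-two-squares : + σmex N ≋
    ∑ℤ (2 ℕ.+ N ℕ.* 6) (λ y → ∑ℤ (2 ℕ.+ N ℕ.* 6) (λ z →
      χ y ℤ.* χ z ℤ.* δ (pentagonal y ℕ.+ pentagonal z) N))
  -- Stage N of `T` is the right one: `partitions N` unfolds to `partitionsLE N N`, so the
  -- coefficient of q^N in `T N` is `σmex N`.
  σmex-two-squares = ≋-trans (coefficient (S≈E*E (T N) A*S≈Ψ) N ℕ.≤-refl)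
    (monomial-sums (2 ℕ.+ N ℕ.* 6) (2 ℕ.+ N ℕ.* 6) χ χ pentagonal pentagonal _ _
      (λ y → *-congˡ (X^ (pentagonal y))) (λ y → *-congˡ (X^ (pentagonal y))))

  σmex-square+12square : + σmex N ≋
    ∑ℤ (2 ℕ.+ N ℕ.* 6) (λ y → ∑ℤ (suc N) (λ z →
      χ y ℤ.* squareWeight z ℤ.* δ (pentagonal y ℕ.+ pentagonal y ℕ.+ z ℕ.* z) N))
  σmex-square+12square = ≋-trans (coefficient (S≈E₂*Φ (T N) A*S≈Ψ) N ℕ.≤-refl)
    (monomial-sums (2 ℕ.+ N ℕ.* 6) (suc N) χ squareWeight (λ y → pentagonal y ℕ.+ pentagonal y) (λ z → z ℕ.* z) _ _
      (λ y → *-congˡ (X²^ (pentagonal y))) (λ z → *-congˡ (X^ (z ℕ.* z))))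
    where
    X²^ : ∀ e → (X * X) ^ e ~ δ (e ℕ.+ e)
    X²^ e = trans (^-distrib-* X X e) (trans (*-cong (X^ e) (X^ e)) (≗⇒~ (δ-⊛-δ e e)))

-- Inert primes in ℤ[i] and ℤ[ω]

module InertPrimes where

  open Algebra.Properties.CommutativeSemiring.Exp ℤ.+-*-commutativeSemiring
  open Algebra.Properties.Semiring.Sum ℤ.+-*-semiring using (sum-init-last) renaming (sum to sumFin)
  open Algebra.Properties.Semiring.Mult ℤ.+-*-semiring using () renaming (_×_ to _·_)

  ·≡* : ∀ n x → n · x ≡ + n ℤ.* x
  ·≡* zero    x = refl
  ·≡* (suc n) x = ≡.trans (cong (λ w → x ℤ.+ w) (·≡* n x)) (≡.sym (ℤ.suc-* (+ n) x))

  module _ {p : ℕ} (pp : Prime p) where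

    open Congruence (+ p)

    private
      1<p : 1 ℕ.< p
      1<p = ℕ.nonTrivial⇒n>1 p {{prime⇒nonTrivial pp}}

      instance
        p≢0 : ℕ.NonZero p
        p≢0 = prime⇒nonZero pp

    prime∤! : ∀ k → k ℕ.< p → ¬ (p ∣ k !)
    prime∤! zero    k<p p∣1 = ℕ.<⇒≱ 1<p (ℕ.∣⇒≤ p∣1)
    prime∤! (suc k) k<p p∣! with euclidsLemma (suc k) (k !) pp p∣!
    ... | inj₁ p∣k = ℕ.<⇒≱ k<p (ℕ.∣⇒≤ p∣k)
    ... | inj₂ p∣k! = prime∤! k (ℕ.<-trans (ℕ.n<1+n k) k<p) p∣k!

    -- p divides p! = C(p, k) k! (p - k)!, and by `prime∤!` it divides neither factorial on the
    -- right.
    prime∣C : ∀ k → 0 ℕ.< k → k ℕ.< p → p ∣ p C k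
    prime∣C k 0<k k<p with euclidsLemma (p C k) (k ! ℕ.* (p ℕ.∸ k) !) pp p∣product
      where
      instance _ = ℕ.m*n≢0 (k !) ((p ℕ.∸ k) !) {{k ℕ.!≢0}} {{(p ℕ.∸ k) ℕ.!≢0}}
      p∣p! : ∀ {p} → .{{ℕ.NonZero p}} → p ∣ p !
      p∣p! {suc p} = ℕ.m∣m*n (p !)
      p!≡ : (p C k) ℕ.* (k ! ℕ.* (p ℕ.∸ k) !) ≡ p !
      p!≡ = ≡.trans (cong (ℕ._* (k ! ℕ.* (p ℕ.∸ k) !)) (nCk≡n!/k![n-k]! (ℕ.<⇒≤ k<p)))
        (ℕ.m/n*n≡m (k![n∸k]!∣n! (ℕ.<⇒≤ k<p)))
      p∣product : p ∣ (p C k) ℕ.* (k ! ℕ.* (p ℕ.∸ k) !)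
      p∣product = subst (p ∣_) (≡.sym p!≡) p∣p!
    ... | inj₁ p∣C = p∣C
    ... | inj₂ p∣!! with euclidsLemma (k !) ((p ℕ.∸ k) !) pp p∣!!
    ... | inj₁ p∣! = ⊥-elim (prime∤! k k<p p∣!)
    ... | inj₂ p∣! = ⊥-elim (prime∤! (p ℕ.∸ k) (ℕ.∸-monoʳ-< 0<k (ℕ.<⇒≤ k<p)) p∣!)

  1^ : ∀ n → (+ 1) ^ n ≡ + 1
  1^ zero    = refl
  1^ (suc n) = ≡.trans (ℤ.*-identityˡ _) (1^ n)

  freshman : ∀ {p} → Prime p → ∀ a → let open Congruence (+ p) in (a ℤ.+ + 1) ^ p ≋ a ^ p ℤ.+ + 1
  freshman {zero} pp = ⊥-elim (¬prime[0] pp)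
  freshman {p@(suc q)} pp a = ≋-trans (≋-reflexive expansion)
    (≋-trans (≋-+ (≋-reflexive {first} refl) middle≋0+) (≋-reflexive collect))
    where
    open Congruence (+ p)
    open Algebra.Properties.CommutativeSemiring.Binomial ℤ.+-*-commutativeSemiring using (theorem; binomialTerm)
    t : Fin (suc p) → ℤ
    t = binomialTerm a (+ 1) p
    first lastTerm : ℤ
    first = t Fin.zero
    lastTerm = t (Fin.suc (fromℕ q))
    middle : Fin q → ℤ
    middle k = t (Fin.suc (inject₁ k))
    expansion : (a ℤ.+ + 1) ^ p ≡ first ℤ.+ (sumFin middle ℤ.+ lastTerm)
    expansion = ≡.trans (theorem p a (+ 1)) (cong (λ w → first ℤ.+ w) (sum-init-last (t ∘ Fin.suc)))
    sum≋0 : ∀ {n} (s : Fin n → ℤ) → (∀ k → s k ≋ + 0) → sumFin s ≋ + 0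
    sum≋0 {zero}  s s≋0 = ≋-reflexive refl
    sum≋0 {suc n} s s≋0 = ≋-+ (s≋0 Fin.zero) (sum≋0 (s ∘ Fin.suc) (s≋0 ∘ Fin.suc))
    middle≋0 : ∀ k → middle k ≋ + 0
    middle≋0 k = congruent (subst (+ p ℤ.∣_) (≡.sym (≡.trans (ℤ.+-identityʳ _) (·≡* (p C j) x)))
      (ℤ.∣m⇒∣m*n {m = + (p C j)} x (ℤ.∣ᵤ⇒∣ {i = + (p C j)} (prime∣C pp j (ℕ.s≤s ℕ.z≤n) (ℕ.s≤s (subst (ℕ._< q) (≡.sym (Fin.toℕ-inject₁ k)) (Fin.toℕ<n k)))))))
      where
      j = suc (toℕ (inject₁ k))
      x = a ^ j ℤ.* (+ 1) ^ (p ℕ.∸ j)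
    first≡1 : first ≡ + 1
    first≡1 = ≡.trans (ℤ.+-identityʳ _) (≡.trans (ℤ.*-identityˡ _) (1^ p))
    last≡ : lastTerm ≡ a ^ p
    last≡ = begin
      (p C suc (toℕ (fromℕ q))) · (a ^ suc (toℕ (fromℕ q)) ℤ.* (+ 1) ^ (q ℕ.∸ toℕ (fromℕ q)))
        ≡⟨ cong (λ j → (p C suc j) · (a ^ suc j ℤ.* (+ 1) ^ (q ℕ.∸ j))) (Fin.toℕ-fromℕ q) ⟩
      (p C p) · (a ^ p ℤ.* (+ 1) ^ (q ℕ.∸ q))
        ≡⟨ cong₂ (λ c e → c · (a ^ p ℤ.* e)) (nCn≡1 p) (1^ (q ℕ.∸ q)) ⟩
      a ^ p ℤ.* + 1 ℤ.+ + 0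
        ≡⟨ ≡.trans (ℤ.+-identityʳ _) (ℤ.*-identityʳ _) ⟩
      a ^ p ∎
      where open ≡.≡-Reasoning
    middle≋0+ : sumFin middle ℤ.+ lastTerm ≋ + 0 ℤ.+ lastTerm
    middle≋0+ = ≋-+ (sum≋0 middle middle≋0) (≋-reflexive refl)
    collect : first ℤ.+ (+ 0 ℤ.+ lastTerm) ≡ a ^ p ℤ.+ + 1
    collect = ≡.trans (cong₂ (λ u v → u ℤ.+ (+ 0 ℤ.+ v)) first≡1 last≡)
      (≡.trans (cong (λ w → + 1 ℤ.+ w) (ℤ.+-identityˡ (a ^ p))) (ℤ.+-comm (+ 1) (a ^ p)))

  -- `freshman` carries the congruence from a to a + 1 and back again, so starting from 0 it reaches
  -- all integers. Negative ones do occur: `cube-roots` is applied to a difference w - y.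
  fermat : ∀ {p} → Prime p → ∀ a → let open Congruence (+ p) in a ^ p ≋ a
  fermat {zero} pp = ⊥-elim (¬prime[0] pp)
  fermat {p@(suc q)} pp = go
    where
    open Congruence (+ p)
    up : ∀ a → a ^ p ≋ a → (a ℤ.+ + 1) ^ p ≋ a ℤ.+ + 1
    up a IH = ≋-trans (freshman pp a) (≋-+ IH (≋-reflexive refl))
    down : ∀ a → (a ℤ.+ + 1) ^ p ≋ a ℤ.+ + 1 → a ^ p ≋ a
    down a IH = ≋-trans (≋-reflexive (≡.sym (cancel (a ^ p))))
      (≋-trans (≋-+ (≋-trans (≋-sym (freshman pp a)) IH) (≋-reflexive refl)) (≋-reflexive (cancel a)))
      where
      cancel : ∀ a → a ℤ.+ + 1 ℤ.+ ℤ.- (+ 1) ≡ a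
      cancel = ℤSolver.solve-∀
    go : ∀ a → a ^ p ≋ a
    go (+ zero)        = ≋-reflexive refl
    go (+ suc n)       = subst (λ a → a ^ p ≋ a) (cong +_ (ℕ.+-comm n 1)) (up (+ n) (go (+ n)))
    go -[1+ zero ]     = down -[1+ 0 ] (go (+ 0))
    go -[1+ suc n ]    = down -[1+ suc n ] (go -[1+ n ])

  module _ {p : ℕ} (pp : Prime p) where

    open Congruence (+ p)

    euclid : ∀ i j → i ℤ.* j ≋ + 0 → i ≋ + 0 ⊎ j ≋ + 0
    euclid i j (congruent d) with euclidsLemma ℤ.∣ i ∣ ℤ.∣ j ∣ pp
      (subst (p ∣_) (≡.trans (cong ℤ.∣_∣ (ℤ.+-identityʳ (i ℤ.* j))) (ℤ.abs-* i j)) (ℤ.∣⇒∣ᵤ d))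
    ... | inj₁ p∣i = inj₁ (congruent (subst (+ p ℤ.∣_) (≡.sym (ℤ.+-identityʳ i)) (ℤ.∣ᵤ⇒∣ p∣i)))
    ... | inj₂ p∣j = inj₂ (congruent (subst (+ p ℤ.∣_) (≡.sym (ℤ.+-identityʳ j)) (ℤ.∣ᵤ⇒∣ p∣j)))

    ≋0⇒∣ : ∀ {i} → i ≋ + 0 → p ∣ ℤ.∣ i ∣
    ≋0⇒∣ {i} (congruent d) = subst (λ w → p ∣ ℤ.∣ w ∣) (ℤ.+-identityʳ i) (ℤ.∣⇒∣ᵤ d)

    ∣⇒≋0 : ∀ {n} → p ∣ n → + n ≋ + 0
    ∣⇒≋0 {n} p∣n = congruent (subst (+ p ℤ.∣_) (≡.sym (ℤ.+-identityʳ (+ n))) (ℤ.∣ᵤ⇒∣ p∣n))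

    square≋0 : ∀ i → i ℤ.* i ≋ + 0 → i ≋ + 0
    square≋0 i eq = [ id , id ] (euclid i i eq)

    ^-cong-≋ : ∀ n {i j} → i ≋ j → i ^ n ≋ j ^ n
    ^-cong-≋ zero    i≋j = ≋-reflexive refl
    ^-cong-≋ (suc n) i≋j = ≋-* i≋j (^-cong-≋ n i≋j)

    ≋0-*ˡ : ∀ i {j} → j ≋ + 0 → i ℤ.* j ≋ + 0
    ≋0-*ˡ i j≋0 = ≋-trans (≋-* (≋-reflexive {i} refl) j≋0) (≋-reflexive (ℤ.*-zeroʳ i))

    -- From u = y², v = z² and u ≡ - v one gets y ≡ yᵖ = y u (u²)ᵗ and z ≡ - z u (u²)ᵗ, whence 2 y z ≡ 0.
    inert-Gaussian : ∀ t → p ≡ 4 ℕ.* t ℕ.+ 3 → ∀ y z → p ∣ y ℕ.* y ℕ.+ z ℕ.* z → p ∣ y × p ∣ z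
    inert-Gaussian t p≡ y z p∣ = finish (euclid (+ 2) (Y ℤ.* Z) 2YZ≋0)
      where
      Y = + y
      Z = + z
      u = Y ℤ.* Y
      v = Z ℤ.* Z
      u+v≋0 : u ℤ.+ v ≋ + 0
      u+v≋0 = ≋-trans (≋-reflexive (≡.sym (≡.trans (ℤ.pos-+ (y ℕ.* y) (z ℕ.* z)) (cong₂ ℤ._+_ (ℤ.pos-* y y) (ℤ.pos-* z z))))) (∣⇒≋0 p∣)
      v+u≋0 : v ℤ.+ u ≋ + 0
      v+u≋0 = ≋-trans (≋-reflexive (ℤ.+-comm v u)) u+v≋0
      power : ∀ w → w ≋ w ℤ.* (w ℤ.* w) ℤ.* (w ℤ.* w ℤ.* (w ℤ.* w)) ^ t
      power w = ≋-trans (≋-sym (fermat pp w)) (≋-reflexive (begin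
        w ^ p                                     ≡⟨ cong (w ^_) p≡ ⟩
        w ^ (4 ℕ.* t ℕ.+ 3)                       ≡⟨ ^-homo-* w (4 ℕ.* t) 3 ⟩
        w ^ (4 ℕ.* t) ℤ.* w ^ 3                   ≡⟨ cong (λ s → s ℤ.* w ^ 3) (^-assocʳ w 4 t) ⟨
        (w ^ 4) ^ t ℤ.* w ^ 3                     ≡⟨ cong (λ s → s ^ t ℤ.* w ^ 3) (fourth w) ⟩
        (w ℤ.* w ℤ.* (w ℤ.* w)) ^ t ℤ.* w ^ 3     ≡⟨ reorder w ((w ℤ.* w ℤ.* (w ℤ.* w)) ^ t) ⟩
        w ℤ.* (w ℤ.* w) ℤ.* (w ℤ.* w ℤ.* (w ℤ.* w)) ^ t ∎))
        where
        open ≡.≡-Reasoning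
        fourth : ∀ w → w ℤ.* (w ℤ.* (w ℤ.* (w ℤ.* + 1))) ≡ w ℤ.* w ℤ.* (w ℤ.* w)
        fourth = ℤSolver.solve-∀
        reorder : ∀ w s → s ℤ.* (w ℤ.* (w ℤ.* (w ℤ.* + 1))) ≡ w ℤ.* (w ℤ.* w) ℤ.* s
        reorder = ℤSolver.solve-∀
      u²≋v² : u ℤ.* u ≋ v ℤ.* v
      u²≋v² = congruent (subst (+ p ℤ.∣_) (difference u v) (ℤ.∣m⇒∣m*n (u ℤ.- v) (divisible u+v≋0)))
        where
        difference : ∀ u v → (u ℤ.+ v ℤ.- + 0) ℤ.* (u ℤ.- v) ≡ u ℤ.* u ℤ.- v ℤ.* v
        difference = ℤSolver.solve-∀
      c = (u ℤ.* u) ^ t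
      2YZ≋0 : + 2 ℤ.* (Y ℤ.* Z) ≋ + 0
      2YZ≋0 = ≋-trans (≋-reflexive (double Y Z)) (≋-trans
        (≋-+ (≋-* (power Y) (≋-reflexive {Z} refl))
             (≋-* (≋-reflexive {Y} refl)
               (≋-trans (power Z) (≋-* (≋-reflexive {Z ℤ.* v} refl) (^-cong-≋ t (≋-sym u²≋v²))))))
        (≋-trans (≋-reflexive (factor Y Z u v c)) (≋0-*ˡ (Y ℤ.* Z ℤ.* c) u+v≋0)))
        where
        double : ∀ Y Z → + 2 ℤ.* (Y ℤ.* Z) ≡ Y ℤ.* Z ℤ.+ Y ℤ.* Z
        double = ℤSolver.solve-∀
        factor : ∀ Y Z u v c → Y ℤ.* u ℤ.* c ℤ.* Z ℤ.+ Y ℤ.* (Z ℤ.* v ℤ.* c) ≡ Y ℤ.* Z ℤ.* c ℤ.* (u ℤ.+ v)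
        factor = ℤSolver.solve-∀
      other : ∀ a b → a ℤ.* a ℤ.+ b ℤ.* b ≋ + 0 → a ≋ + 0 → b ≋ + 0
      other a b eq a≋0 = square≋0 b (≋-trans (≋-reflexive (≡.sym (ℤ.+-identityˡ (b ℤ.* b))))
        (≋-trans (≋-+ (≋-sym (≋0-*ˡ a a≋0)) (≋-reflexive {b ℤ.* b} refl)) eq))
      3≤p : 3 ℕ.≤ p
      3≤p = subst (3 ℕ.≤_) (≡.sym p≡) (ℕ.m≤n+m 3 (4 ℕ.* t))
      finish : + 2 ≋ + 0 ⊎ Y ℤ.* Z ≋ + 0 → p ∣ y × p ∣ z
      finish (inj₁ 2≋0) = ⊥-elim (ℕ.<⇒≱ 3≤p (ℕ.∣⇒≤ (≋0⇒∣ 2≋0)))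
      finish (inj₂ YZ≋0) with euclid Y Z YZ≋0
      ... | inj₁ Y≋0 = ≋0⇒∣ Y≋0 , ≋0⇒∣ (other Y Z u+v≋0 Y≋0)
      ... | inj₂ Z≋0 = ≋0⇒∣ (other Z Y v+u≋0 Z≋0) , ≋0⇒∣ Z≋0

    -- a³ ≡ b³ turns a ≡ aᵖ and b ≡ bᵖ into a ≡ a² c and b ≡ b² c with the same c, so ab² ≡ a²b.
    cube-roots : ∀ t → p ≡ 3 ℕ.* t ℕ.+ 2 → ∀ a b → a ℤ.* a ℤ.+ a ℤ.* b ℤ.+ b ℤ.* b ≋ + 0 →
      a ℤ.* b ℤ.* (a ℤ.- b) ≋ + 0
    cube-roots t p≡ a b form≋0 = congruent (subst (+ p ℤ.∣_) (difference a b) (ℤ.∣m⇒∣-m (divisible ab²≋ba²)))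
      where
      power : ∀ w → w ≋ w ℤ.* w ℤ.* (w ℤ.* w ℤ.* w) ^ t
      power w = ≋-trans (≋-sym (fermat pp w)) (≋-reflexive (begin
        w ^ p                                 ≡⟨ cong (w ^_) p≡ ⟩
        w ^ (3 ℕ.* t ℕ.+ 2)                   ≡⟨ ^-homo-* w (3 ℕ.* t) 2 ⟩
        w ^ (3 ℕ.* t) ℤ.* w ^ 2               ≡⟨ cong (λ s → s ℤ.* w ^ 2) (^-assocʳ w 3 t) ⟨
        (w ^ 3) ^ t ℤ.* w ^ 2                 ≡⟨ cong (λ s → s ^ t ℤ.* w ^ 2) (cube w) ⟩
        (w ℤ.* w ℤ.* w) ^ t ℤ.* w ^ 2         ≡⟨ reorder w ((w ℤ.* w ℤ.* w) ^ t) ⟩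
        w ℤ.* w ℤ.* (w ℤ.* w ℤ.* w) ^ t       ∎))
        where
        open ≡.≡-Reasoning
        cube : ∀ w → w ℤ.* (w ℤ.* (w ℤ.* + 1)) ≡ w ℤ.* w ℤ.* w
        cube = ℤSolver.solve-∀
        reorder : ∀ w s → s ℤ.* (w ℤ.* (w ℤ.* + 1)) ≡ w ℤ.* w ℤ.* s
        reorder = ℤSolver.solve-∀
      a³≋b³ : a ℤ.* a ℤ.* a ≋ b ℤ.* b ℤ.* b
      a³≋b³ = congruent (subst (+ p ℤ.∣_) (cubes a b) (ℤ.∣m⇒∣m*n (a ℤ.- b) (divisible form≋0)))
        where
        cubes : ∀ a b → (a ℤ.* a ℤ.+ a ℤ.* b ℤ.+ b ℤ.* b ℤ.- + 0) ℤ.* (a ℤ.- b) ≡ a ℤ.* a ℤ.* a ℤ.- b ℤ.* b ℤ.* b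
        cubes = ℤSolver.solve-∀
      c = (a ℤ.* a ℤ.* a) ^ t
      ab²≋ba² : a ℤ.* (b ℤ.* b) ≋ b ℤ.* (a ℤ.* a)
      ab²≋ba² = ≋-trans (≋-* (power a) (≋-reflexive {b ℤ.* b} refl))
        (≋-trans (≋-reflexive (swap a b c)) (≋-sym (≋-* b≋ (≋-reflexive {a ℤ.* a} refl))))
        where
        b≋ : b ≋ b ℤ.* b ℤ.* c
        b≋ = ≋-trans (power b) (≋-* (≋-reflexive {b ℤ.* b} refl) (^-cong-≋ t (≋-sym a³≋b³)))
        swap : ∀ a b c → a ℤ.* a ℤ.* c ℤ.* (b ℤ.* b) ≡ b ℤ.* b ℤ.* c ℤ.* (a ℤ.* a)
        swap = ℤSolver.solve-∀
      difference : ∀ a b → ℤ.- (a ℤ.* (b ℤ.* b) ℤ.- b ℤ.* (a ℤ.* a)) ≡ a ℤ.* b ℤ.* (a ℤ.- b) ℤ.- + 0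
      difference = ℤSolver.solve-∀

    module _ (t : ℕ) (p≡ : p ≡ 3 ℕ.* t ℕ.+ 2) (4<p : 4 ℕ.< p) where

      private
        cancel : ∀ k → .{{ℕ.NonZero k}} → k ℕ.≤ 4 → ∀ i → + k ℤ.* i ≋ + 0 → i ≋ + 0
        cancel k k≤4 i eq = [ (λ k≋0 → ⊥-elim (ℕ.<⇒≱ (ℕ.≤-<-trans k≤4 4<p) (ℕ.∣⇒≤ (≋0⇒∣ k≋0)))) , id ] (euclid (+ k) i eq)

      -- For a = w + y and b = w - y: a² + ab + b² = y² + 3w², a - b = 2y, and 4y² = (y² + 3w²) - 3ab.
      inert-y²+3w² : ∀ Y W → Y ℤ.* Y ℤ.+ + 3 ℤ.* (W ℤ.* W) ≋ + 0 → Y ≋ + 0 × W ≋ + 0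
      inert-y²+3w² Y W form≋0 = Y≋0 , W≋0
        where
        from-product : (W ℤ.+ Y) ℤ.* (W ℤ.- Y) ≋ + 0 → Y ≋ + 0
        from-product ab≋0 = square≋0 Y (cancel 4 ℕ.≤-refl (Y ℤ.* Y)
          (≋-trans (≋-reflexive (combine Y W)) (≋-+ form≋0 (≋0-*ˡ (ℤ.- (+ 3)) ab≋0))))
          where
          combine : ∀ Y W → + 4 ℤ.* (Y ℤ.* Y) ≡ (Y ℤ.* Y ℤ.+ + 3 ℤ.* (W ℤ.* W)) ℤ.+ ℤ.- (+ 3) ℤ.* ((W ℤ.+ Y) ℤ.* (W ℤ.- Y))
          combine = ℤSolver.solve-∀
        product≋0 : (W ℤ.+ Y) ℤ.* (W ℤ.- Y) ℤ.* ((W ℤ.+ Y) ℤ.- (W ℤ.- Y)) ≋ + 0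
        product≋0 = cube-roots t p≡ (W ℤ.+ Y) (W ℤ.- Y) (≋-trans (≋-reflexive (expand Y W)) form≋0)
          where
          expand : ∀ Y W → (W ℤ.+ Y) ℤ.* (W ℤ.+ Y) ℤ.+ (W ℤ.+ Y) ℤ.* (W ℤ.- Y) ℤ.+ (W ℤ.- Y) ℤ.* (W ℤ.- Y) ≡ Y ℤ.* Y ℤ.+ + 3 ℤ.* (W ℤ.* W)
          expand = ℤSolver.solve-∀
        from-difference : (W ℤ.+ Y) ℤ.- (W ℤ.- Y) ≋ + 0 → Y ≋ + 0
        from-difference eq = cancel 2 (ℕ.s≤s (ℕ.s≤s ℕ.z≤n)) Y (≋-trans (≋-reflexive (double Y W)) eq)
          where
          double : ∀ Y W → + 2 ℤ.* Y ≡ (W ℤ.+ Y) ℤ.- (W ℤ.- Y)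
          double = ℤSolver.solve-∀
        Y≋0 : Y ≋ + 0
        Y≋0 = [ from-product , from-difference ] (euclid ((W ℤ.+ Y) ℤ.* (W ℤ.- Y)) _ product≋0)
        W≋0 : W ≋ + 0
        W≋0 = square≋0 W (cancel 3 (ℕ.s≤s (ℕ.s≤s (ℕ.s≤s ℕ.z≤n))) (W ℤ.* W)
          (≋-trans (≋-reflexive (combine Y W)) (≋-+ form≋0 (≋0-*ˡ (ℤ.- Y) Y≋0))))
          where
          combine : ∀ Y W → + 3 ℤ.* (W ℤ.* W) ≡ (Y ℤ.* Y ℤ.+ + 3 ℤ.* (W ℤ.* W)) ℤ.+ ℤ.- Y ℤ.* Y
          combine = ℤSolver.solve-∀

      -- 12z² = 3(2z)² brings the form to y² + 3w² with w = 2z, and p > 4 allows the factor 2 to be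
      -- cancelled afterwards.
      inert-Eisenstein : ∀ y z → p ∣ y ℕ.* y ℕ.+ 12 ℕ.* (z ℕ.* z) → p ∣ y × p ∣ z
      inert-Eisenstein y z p∣ =
        ≋0⇒∣ (proj₁ both) , ≋0⇒∣ (cancel 2 (ℕ.s≤s (ℕ.s≤s ℕ.z≤n)) (+ z) (≋-trans (≋-reflexive (≡.sym (ℤ.pos-* 2 z))) (proj₂ both)))
        where
        rescale : ∀ y z → y ℕ.* y ℕ.+ 12 ℕ.* (z ℕ.* z) ≡ y ℕ.* y ℕ.+ 3 ℕ.* (2 ℕ.* z ℕ.* (2 ℕ.* z))
        rescale = ℕSolver.solve-∀
        cast : ∀ y w → + (y ℕ.* y ℕ.+ 3 ℕ.* (w ℕ.* w)) ≡ + y ℤ.* + y ℤ.+ + 3 ℤ.* (+ w ℤ.* + w)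
        cast y w = ≡.trans (ℤ.pos-+ (y ℕ.* y) (3 ℕ.* (w ℕ.* w)))
          (cong₂ ℤ._+_ (ℤ.pos-* y y) (≡.trans (ℤ.pos-* 3 (w ℕ.* w)) (cong (λ v → + 3 ℤ.* v) (ℤ.pos-* w w))))
        both : + y ≋ + 0 × + (2 ℕ.* z) ≋ + 0
        both = inert-y²+3w² (+ y) (+ (2 ℕ.* z))
          (≋-trans (≋-reflexive (≡.sym (cast y (2 ℕ.* z)))) (∣⇒≋0 (subst (p ∣_) (rescale y z) p∣)))

-- Representations by quadratic forms under dilation by p

open Summation ℤ.+-*-commutativeRing

∑-extend : ∀ {a} (t : ℕ → ℤ) → (∀ i → a ℕ.≤ i → t i ≡ + 0) → ∀ {b} → a ℕ.≤ b → ∑ b t ≡ ∑ a t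
∑-extend {a} t t≡0 {b} a≤b = subst (λ b → ∑ b t ≡ ∑ a t) (ℕ.m∸n+n≡m a≤b) (go (b ℕ.∸ a))
  where
  go : ∀ j → ∑ (j ℕ.+ a) t ≡ ∑ a t
  go zero    = refl
  go (suc j) = ≡.trans (cong₂ ℤ._+_ (go j) (t≡0 (j ℕ.+ a) (ℕ.m≤n+m a j))) (ℤ.+-identityʳ _)

-- The range splits into L blocks of p consecutive indices, and in each block only the first index
-- is a multiple of p.
∑-dilate : ∀ p .{{_ : ℕ.NonZero p}} (t : ℕ → ℤ) → (∀ i → ¬ (p ∣ i) → t i ≡ + 0) →
  ∀ L → ∑ (L ℕ.* p) t ≡ ∑ L (λ i → t (i ℕ.* p))
∑-dilate p t t≡0 zero = refl
∑-dilate p@(suc q) t t≡0 (suc L) = begin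
  ∑ (suc (q ℕ.+ L ℕ.* p)) t        ≡⟨ cong (λ l → ∑ l t) (ℕ.+-suc q (L ℕ.* p)) ⟨
  ∑ (q ℕ.+ suc (L ℕ.* p)) t        ≡⟨ block q ℕ.≤-refl ⟩
  ∑ (L ℕ.* p) t ℤ.+ t (L ℕ.* p)    ≡⟨ cong (λ w → w ℤ.+ t (L ℕ.* p)) (∑-dilate p t t≡0 L) ⟩
  ∑ L (λ i → t (i ℕ.* p)) ℤ.+ t (L ℕ.* p) ∎
  where
  open ≡.≡-Reasoning
  block : ∀ j → j ℕ.≤ q → ∑ (j ℕ.+ suc (L ℕ.* p)) t ≡ ∑ (suc (L ℕ.* p)) t
  block zero    _   = refl
  block (suc j) j<q = ≡.trans (cong₂ ℤ._+_ (block j (ℕ.<⇒≤ j<q)) (t≡0 _ indivisible)) (ℤ.+-identityʳ _)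
    where
    indivisible : ¬ (p ∣ j ℕ.+ suc (L ℕ.* p))
    indivisible p∣ = ℕ.<⇒≱ (ℕ.s≤s j<q) (ℕ.∣⇒≤
      (ℕ.∣m+n∣m⇒∣n (subst (p ∣_) (≡.trans (ℕ.+-suc j (L ℕ.* p)) (ℕ.+-comm (suc j) (L ℕ.* p))) p∣) (ℕ.n∣m*n L)))

δ-iff : ∀ {a b c d} → (a ≡ b → c ≡ d) → (c ≡ d → a ≡ b) → δ a b ≡ δ c d
δ-iff {a} {b} {c} {d} to from with a ℕ.≟ b
... | yes refl = ≡.trans (δ-refl a) (≡.sym (≡.trans (cong (δ c) (≡.sym (to refl))) (δ-refl c)))
... | no a≢b = ≡.trans (δ-≢ a b a≢b) (≡.sym (δ-≢ c d (a≢b ∘ from)))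

module Representations (u v : ℕ → ℤ) (Q : ℕ → ℕ → ℕ) where

  weight : ℕ → ℕ → ℕ → ℤ
  weight t y z = u y ℤ.* v z ℤ.* δ (Q y z) t

  count : ℕ → ℕ → ℕ → ℤ
  count t a b = ∑ a (λ y → ∑ b (weight t y))

  weight-0 : ∀ t y z → Q y z ≢ t → weight t y z ≡ + 0
  weight-0 t y z ≢t = ≡.trans (cong (λ w → u y ℤ.* v z ℤ.* w) (δ-≢ (Q y z) t ≢t)) (ℤ.*-zeroʳ (u y ℤ.* v z))

  ∑-0 : ∀ n {s : ℕ → ℤ} → (∀ i → s i ≡ + 0) → ∑ n s ≡ + 0
  ∑-0 n {s} s≡0 = ∑-extend {0} s (λ i _ → s≡0 i) {n} ℕ.z≤n

  -- Says that the box contains every solution, so the count does not change when the box grows. The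
  -- truncated theta series for two different arguments of `σmex` come with different boxes, which
  -- must be made comparable.
  Bounded : ℕ → ℕ → ℕ → Set
  Bounded t a b = ∀ y z → Q y z ≡ t → y ℕ.< a × z ℕ.< b

  count-extend : ∀ {t a b a′ b′} → Bounded t a b → a ℕ.≤ a′ → b ℕ.≤ b′ → count t a′ b′ ≡ count t a b
  count-extend {t} {a} {b} {a′} {b′} bounded a≤a′ b≤b′ = ≡.trans
    (∑-cong a′ λ y → ∑-extend (weight t y) (λ z b≤z → weight-0 t y z λ eq → ℕ.<⇒≱ (proj₂ (bounded y z eq)) b≤z) b≤b′)
    (∑-extend (λ y → ∑ b (weight t y)) (λ y a≤y → ∑-0 b λ z → weight-0 t y z λ eq → ℕ.<⇒≱ (proj₁ (bounded y z eq)) a≤y) a≤a′)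

  module _ (p : ℕ) .{{_ : ℕ.NonZero p}} (ε : ℤ) (t t′ : ℕ) (t≡ : t ≡ p ℕ.* p ℕ.* t′)
    (inert : ∀ y z → p ∣ Q y z → p ∣ y × p ∣ z)
    (Q-homogeneous : ∀ y z → Q (y ℕ.* p) (z ℕ.* p) ≡ p ℕ.* p ℕ.* Q y z)
    (u*v-dilate : ∀ y z → u (y ℕ.* p) ℤ.* v (z ℕ.* p) ≡ ε ℤ.* (u y ℤ.* v z)) where

    private
      p∣t : p ∣ t
      p∣t = subst (p ∣_) (≡.sym t≡) (ℕ.∣m⇒∣m*n t′ (ℕ.m∣m*n p))

      inert′ : ∀ y z → Q y z ≡ t → p ∣ y × p ∣ z
      inert′ y z eq = inert y z (subst (p ∣_) (≡.sym eq) p∣t)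

      δ-dilate : ∀ y z → δ (Q (y ℕ.* p) (z ℕ.* p)) t ≡ δ (Q y z) t′
      δ-dilate y z = δ-iff
        (λ eq → ℕ.*-cancelˡ-≡ _ _ (p ℕ.* p) {{ℕ.m*n≢0 p p}} (≡.trans (≡.sym (Q-homogeneous y z)) (≡.trans eq t≡)))
        (λ eq → ≡.trans (Q-homogeneous y z) (≡.trans (cong (p ℕ.* p ℕ.*_) eq) (≡.sym t≡)))

      weight-dilate : ∀ y z → weight t (y ℕ.* p) (z ℕ.* p) ≡ ε ℤ.* weight t′ y z
      weight-dilate y z = ≡.trans (cong₂ ℤ._*_ (u*v-dilate y z) (δ-dilate y z)) (ℤ.*-assoc ε (u y ℤ.* v z) (δ (Q y z) t′))

    -- By inertness (y, z) ↦ (yp, zp) is a bijection from the solutions for t′ onto those for t. The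
    -- boxes are enlarged to side L p for t and side L for t′; L is the sum of the four given
    -- bounds, hence at least each of them.
    count-dilate : ∀ {a b a′ b′} → Bounded t a b → Bounded t′ a′ b′ → count t a b ≡ ε ℤ.* count t′ a′ b′
    count-dilate {a} {b} {a′} {b′} bounded bounded′ = begin
      count t a b
        ≡⟨ count-extend bounded (≤Lp (ℕ.≤-trans (ℕ.m≤m+n a b) (ℕ.m≤m+n (a ℕ.+ b) _)))
             (≤Lp (ℕ.≤-trans (ℕ.m≤n+m b a) (ℕ.m≤m+n (a ℕ.+ b) _))) ⟨
      count t (L ℕ.* p) (L ℕ.* p)
        ≡⟨ ∑-dilate p (λ y → ∑ (L ℕ.* p) (weight t y)) (λ y p∤y → ∑-0 (L ℕ.* p) λ z → weight-0 t y z (p∤y ∘ proj₁ ∘ inert′ y z)) L ⟩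
      ∑ L (λ y → ∑ (L ℕ.* p) (weight t (y ℕ.* p)))
        ≡⟨ ∑-cong L (λ y → ∑-dilate p (weight t (y ℕ.* p)) (λ z p∤z → weight-0 t (y ℕ.* p) z (p∤z ∘ proj₂ ∘ inert′ (y ℕ.* p) z)) L) ⟩
      ∑ L (λ y → ∑ L (λ z → weight t (y ℕ.* p) (z ℕ.* p)))
        ≡⟨ ∑-cong L (λ y → ≡.trans (∑-cong L (weight-dilate y)) (≡.sym (*-distribˡ-∑ ε L (weight t′ y)))) ⟩
      ∑ L (λ y → ε ℤ.* ∑ L (weight t′ y))
        ≡⟨ *-distribˡ-∑ ε L (λ y → ∑ L (weight t′ y)) ⟨
      ε ℤ.* count t′ L L
        ≡⟨ cong (λ w → ε ℤ.* w) (count-extend bounded′ (ℕ.≤-trans (ℕ.m≤m+n a′ b′) (ℕ.m≤n+m _ (a ℕ.+ b)))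
             (ℕ.≤-trans (ℕ.m≤n+m b′ a′) (ℕ.m≤n+m _ (a ℕ.+ b)))) ⟩
      ε ℤ.* count t′ a′ b′ ∎
      where
      open ≡.≡-Reasoning
      L = (a ℕ.+ b) ℕ.+ (a′ ℕ.+ b′)
      ≤Lp : ∀ {k} → k ℕ.≤ L → k ℕ.≤ L ℕ.* p
      ≤Lp k≤L = ℕ.≤-trans k≤L (ℕ.m≤m*n L p)

-- The weights under dilation, and exactness of the pentagonal exponent

-- (12 + y)² = y² + 24(y + 6), so the quotient e = (y² - 1)/24 grows by y + 6 in each period, from
-- 0, 1, 2, 5 at y = 1, 5, 7, 11. The induction carries e itself, and only the end identifies it
-- with the rounded division in `pentagonal`.
χ-support : ∀ y → χ y ≡ + 0 ⊎ y ℕ.* y ≡ suc (pentagonal y ℕ.* 24)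
χ-support y with go y
  where
  step : ∀ y e → y ℕ.* y ≡ suc (e ℕ.* 24) → (12 ℕ.+ y) ℕ.* (12 ℕ.+ y) ≡ suc ((e ℕ.+ y ℕ.+ 6) ℕ.* 24)
  step y e eq = ≡.trans (expand y) (≡.trans (cong (ℕ._+ (24 ℕ.* y ℕ.+ 144)) eq) (collect y e))
    where
    expand : ∀ y → (12 ℕ.+ y) ℕ.* (12 ℕ.+ y) ≡ y ℕ.* y ℕ.+ (24 ℕ.* y ℕ.+ 144)
    expand = ℕSolver.solve-∀
    collect : ∀ y e → suc (e ℕ.* 24) ℕ.+ (24 ℕ.* y ℕ.+ 144) ≡ suc ((e ℕ.+ y ℕ.+ 6) ℕ.* 24)
    collect = ℕSolver.solve-∀
  go : ∀ y → χ y ≡ + 0 ⊎ Σ ℕ λ e → y ℕ.* y ≡ suc (e ℕ.* 24)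
  go 0  = inj₁ refl
  go 1  = inj₂ (0 , refl)
  go 2  = inj₁ refl
  go 3  = inj₁ refl
  go 4  = inj₁ refl
  go 5  = inj₂ (1 , refl)
  go 6  = inj₁ refl
  go 7  = inj₂ (2 , refl)
  go 8  = inj₁ refl
  go 9  = inj₁ refl
  go 10 = inj₁ refl
  go 11 = inj₂ (5 , refl)
  go (suc (suc (suc (suc (suc (suc (suc (suc (suc (suc (suc (suc y)))))))))))) with go y
  ... | inj₁ eq = inj₁ eq
  ... | inj₂ (e , eq) = inj₂ (e ℕ.+ y ℕ.+ 6 , step y e eq)
... | inj₁ eq = inj₁ eq
... | inj₂ (e , eq) = inj₂ (≡.trans eq (cong (λ e → suc (e ℕ.* 24)) (≡.sym (pentagonal-unique y e eq))))

-- One period is checked by evaluation; beyond it (12 + y) * 5 exposes 60 successors, from which χ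
-- strips five periods by computation.
χ-*5 : ∀ y → χ (y ℕ.* 5) ≡ ℤ.- χ y
χ-*5 0  = refl
χ-*5 1  = refl
χ-*5 2  = refl
χ-*5 3  = refl
χ-*5 4  = refl
χ-*5 5  = refl
χ-*5 6  = refl
χ-*5 7  = refl
χ-*5 8  = refl
χ-*5 9  = refl
χ-*5 10 = refl
χ-*5 11 = refl
χ-*5 (suc (suc (suc (suc (suc (suc (suc (suc (suc (suc (suc (suc y)))))))))))) = χ-*5 y

χ-*7 : ∀ y → χ (y ℕ.* 7) ≡ ℤ.- χ y
χ-*7 0  = refl
χ-*7 1  = refl
χ-*7 2  = refl
χ-*7 3  = refl
χ-*7 4  = refl
χ-*7 5  = refl
χ-*7 6  = refl
χ-*7 7  = refl
χ-*7 8  = refl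
χ-*7 9  = refl
χ-*7 10 = refl
χ-*7 11 = refl
χ-*7 (suc (suc (suc (suc (suc (suc (suc (suc (suc (suc (suc (suc y)))))))))))) = χ-*7 y

χ-*11 : ∀ y → χ (y ℕ.* 11) ≡ χ y
χ-*11 0  = refl
χ-*11 1  = refl
χ-*11 2  = refl
χ-*11 3  = refl
χ-*11 4  = refl
χ-*11 5  = refl
χ-*11 6  = refl
χ-*11 7  = refl
χ-*11 8  = refl
χ-*11 9  = refl
χ-*11 10 = refl
χ-*11 11 = refl
χ-*11 (suc (suc (suc (suc (suc (suc (suc (suc (suc (suc (suc (suc y)))))))))))) = χ-*11 y

χ-periodic : ∀ k y → χ (k ℕ.* 12 ℕ.+ y) ≡ χ y
χ-periodic zero    y = refl
χ-periodic (suc k) y = χ-periodic k y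

χ-*-mod : ∀ q i y → χ (y ℕ.* (i ℕ.+ q ℕ.* 12)) ≡ χ (y ℕ.* i)
χ-*-mod q i y = ≡.trans (cong χ (rearrange q i y)) (χ-periodic (y ℕ.* q) (y ℕ.* i))
  where
  rearrange : ∀ q i y → y ℕ.* (i ℕ.+ q ℕ.* 12) ≡ y ℕ.* q ℕ.* 12 ℕ.+ y ℕ.* i
  rearrange = ℕSolver.solve-∀

sign-even : ∀ k n → sign (k ℕ.* 2 ℕ.+ n) ≡ sign n
sign-even zero    n = refl
sign-even (suc k) n = sign-even k n

-- Multiplication by an odd number preserves parity and fixes 0, and the weight depends on nothing
-- else.
squareWeight-odd : ∀ k z → squareWeight (z ℕ.* suc (k ℕ.* 2)) ≡ squareWeight z
squareWeight-odd k zero = refl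
squareWeight-odd k (suc z) = cong (λ s → + 2 ℤ.* s)
  (≡.trans (cong sign (rearrange k z)) (sign-even (suc z ℕ.* k) (suc z)))
  where
  rearrange : ∀ k z → suc z ℕ.* suc (k ℕ.* 2) ≡ suc z ℕ.* k ℕ.* 2 ℕ.+ suc z
  rearrange = ℕSolver.solve-∀

-- `σmex` modulo 4 as a weighted count of representations

private
  module TwoSquares = Representations χ χ (λ y z → y ℕ.* y ℕ.+ z ℕ.* z)
  module Square+12Square = Representations χ squareWeight (λ y z → y ℕ.* y ℕ.+ 12 ℕ.* (z ℕ.* z))

  -- 2 + 6N is the number of terms of `pentagonalSum` at stage N. It is large enough because (6N +
  -- 2)² = 36N² + 24N + 4 exceeds 24N + 2.
  square-bound : ∀ y N → y ℕ.* y ℕ.≤ 24 ℕ.* N ℕ.+ 2 → y ℕ.< 2 ℕ.+ N ℕ.* 6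
  square-bound y N y²≤ with y ℕ.<? 2 ℕ.+ N ℕ.* 6
  ... | yes y< = y<
  ... | no y≮ = ⊥-elim (ℕ.<⇒≱ (begin-strict
    24 ℕ.* N ℕ.+ 2                                      <⟨ ℕ.+-monoʳ-< (24 ℕ.* N) (ℕ.s≤s (ℕ.s≤s (ℕ.s≤s (ℕ.z≤n {1})))) ⟩
    24 ℕ.* N ℕ.+ 4                                      ≤⟨ ℕ.m≤m+n _ (36 ℕ.* (N ℕ.* N)) ⟩
    24 ℕ.* N ℕ.+ 4 ℕ.+ 36 ℕ.* (N ℕ.* N)                 ≡⟨ expand N ⟩
    (2 ℕ.+ N ℕ.* 6) ℕ.* (2 ℕ.+ N ℕ.* 6)                 ≤⟨ ℕ.*-mono-≤ (ℕ.≮⇒≥ y≮) (ℕ.≮⇒≥ y≮) ⟩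
    y ℕ.* y                                             ∎) y²≤)
    where
    open ℕ.≤-Reasoning
    expand : ∀ N → 24 ℕ.* N ℕ.+ 4 ℕ.+ 36 ℕ.* (N ℕ.* N) ≡ (2 ℕ.+ N ℕ.* 6) ℕ.* (2 ℕ.+ N ℕ.* 6)
    expand = ℕSolver.solve-∀

  two-squares-bounded : ∀ N → TwoSquares.Bounded (24 ℕ.* N ℕ.+ 2) (2 ℕ.+ N ℕ.* 6) (2 ℕ.+ N ℕ.* 6)
  two-squares-bounded N y z eq =
    square-bound y N (ℕ.≤-trans (ℕ.m≤m+n (y ℕ.* y) (z ℕ.* z)) (ℕ.≤-reflexive eq)) ,
    square-bound z N (ℕ.≤-trans (ℕ.m≤n+m (z ℕ.* z) (y ℕ.* y)) (ℕ.≤-reflexive eq))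

  square+12square-bounded : ∀ N → Square+12Square.Bounded (12 ℕ.* N ℕ.+ 1) (2 ℕ.+ N ℕ.* 6) (suc N)
  square+12square-bounded N y z eq = square-bound y N y²≤ , z<
    where
    open ℕ.≤-Reasoning
    y²≤ : y ℕ.* y ℕ.≤ 24 ℕ.* N ℕ.+ 2
    y²≤ = begin
      y ℕ.* y                               ≤⟨ ℕ.m≤m+n (y ℕ.* y) (12 ℕ.* (z ℕ.* z)) ⟩
      y ℕ.* y ℕ.+ 12 ℕ.* (z ℕ.* z)          ≡⟨ eq ⟩
      12 ℕ.* N ℕ.+ 1                        ≤⟨ ℕ.m≤m+n _ (12 ℕ.* N ℕ.+ 1) ⟩
      12 ℕ.* N ℕ.+ 1 ℕ.+ (12 ℕ.* N ℕ.+ 1)   ≡⟨ double N ⟩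
      24 ℕ.* N ℕ.+ 2                        ∎
      where
      double : ∀ N → 12 ℕ.* N ℕ.+ 1 ℕ.+ (12 ℕ.* N ℕ.+ 1) ≡ 24 ℕ.* N ℕ.+ 2
      double = ℕSolver.solve-∀
    z< : z ℕ.< suc N
    z< with z ℕ.<? suc N
    ... | yes z<N = z<N
    ... | no z≮N = ⊥-elim (ℕ.<⇒≱ (begin-strict
      12 ℕ.* N ℕ.+ 1                        <⟨ ℕ.+-monoʳ-< (12 ℕ.* N) (ℕ.s≤s (ℕ.s≤s (ℕ.z≤n {10}))) ⟩
      12 ℕ.* N ℕ.+ 12                       ≤⟨ ℕ.m≤m+n _ (12 ℕ.* (N ℕ.* N ℕ.+ N)) ⟩
      12 ℕ.* N ℕ.+ 12 ℕ.+ 12 ℕ.* (N ℕ.* N ℕ.+ N) ≡⟨ expand N ⟩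
      12 ℕ.* (suc N ℕ.* suc N)              ≤⟨ ℕ.*-monoʳ-≤ 12 (ℕ.*-mono-≤ (ℕ.≮⇒≥ z≮N) (ℕ.≮⇒≥ z≮N)) ⟩
      12 ℕ.* (z ℕ.* z)                      ≤⟨ ℕ.m≤n+m _ (y ℕ.* y) ⟩
      y ℕ.* y ℕ.+ 12 ℕ.* (z ℕ.* z)          ∎) (ℕ.≤-reflexive eq))
      where
      expand : ∀ N → 12 ℕ.* N ℕ.+ 12 ℕ.+ 12 ℕ.* (N ℕ.* N ℕ.+ N) ≡ 12 ℕ.* (suc N ℕ.* suc N)
      expand = ℕSolver.solve-∀

open Congruence (+ 4)

-- Multiplying the equation of exponents by 24 and adding 2 completes both squares. This needs the
-- exponents to be exact; wherever they are merely rounded χ vanishes, and both sides are 0.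
σmex≋two-squares : ∀ N → + σmex N ≋ TwoSquares.count (24 ℕ.* N ℕ.+ 2) (2 ℕ.+ N ℕ.* 6) (2 ℕ.+ N ℕ.* 6)
σmex≋two-squares N = ≋-trans (GeneratingFunction.σmex-two-squares N)
  (≋-reflexive (∑-cong (2 ℕ.+ N ℕ.* 6) λ y → ∑-cong (2 ℕ.+ N ℕ.* 6) λ z → term y z))
  where
  term : ∀ y z → χ y ℤ.* χ z ℤ.* δ (pentagonal y ℕ.+ pentagonal z) N ≡ TwoSquares.weight (24 ℕ.* N ℕ.+ 2) y z
  term y z with χ-support y | χ-support z
  ... | inj₁ χy≡0 | _ rewrite χy≡0 = refl
  ... | inj₂ _ | inj₁ χz≡0 rewrite χz≡0 | ℤ.*-zeroʳ (χ y) = refl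
  ... | inj₂ y² | inj₂ z² = cong (λ w → χ y ℤ.* χ z ℤ.* w) (δ-iff {pentagonal y ℕ.+ pentagonal z} {N}
    (λ eq → ≡.trans squares (cong (λ w → 24 ℕ.* w ℕ.+ 2) eq))
    (λ eq → ℕ.*-cancelˡ-≡ (pentagonal y ℕ.+ pentagonal z) N 24 (ℕ.+-cancelʳ-≡ 2 _ _ (≡.trans (≡.sym squares) eq))))
    where
    squares : y ℕ.* y ℕ.+ z ℕ.* z ≡ 24 ℕ.* (pentagonal y ℕ.+ pentagonal z) ℕ.+ 2
    squares = ≡.trans (cong₂ ℕ._+_ y² z²) (collect (pentagonal y) (pentagonal z))
      where
      collect : ∀ a b → suc (a ℕ.* 24) ℕ.+ suc (b ℕ.* 24) ≡ 24 ℕ.* (a ℕ.+ b) ℕ.+ 2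
      collect = ℕSolver.solve-∀

-- The pentagonal exponent is doubled because f₂ is a series in q², so the multiplier 12 completes
-- the square: 12(2e + z²) + 1 = y² + 12z² when y² = 24e + 1.
σmex≋square+12square : ∀ N → + σmex N ≋ Square+12Square.count (12 ℕ.* N ℕ.+ 1) (2 ℕ.+ N ℕ.* 6) (suc N)
σmex≋square+12square N = ≋-trans (GeneratingFunction.σmex-square+12square N)
  (≋-reflexive (∑-cong (2 ℕ.+ N ℕ.* 6) λ y → ∑-cong (suc N) λ z → term y z))
  where
  term : ∀ y z → χ y ℤ.* squareWeight z ℤ.* δ (pentagonal y ℕ.+ pentagonal y ℕ.+ z ℕ.* z) N ≡
    Square+12Square.weight (12 ℕ.* N ℕ.+ 1) y z
  term y z with χ-support y
  ... | inj₁ χy≡0 rewrite χy≡0 = refl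
  ... | inj₂ y² = cong (λ w → χ y ℤ.* squareWeight z ℤ.* w) (δ-iff {pentagonal y ℕ.+ pentagonal y ℕ.+ z ℕ.* z} {N}
    (λ eq → ≡.trans squares (cong (λ w → 12 ℕ.* w ℕ.+ 1) eq))
    (λ eq → ℕ.*-cancelˡ-≡ (pentagonal y ℕ.+ pentagonal y ℕ.+ z ℕ.* z) N 12 (ℕ.+-cancelʳ-≡ 1 _ _ (≡.trans (≡.sym squares) eq))))
    where
    squares : y ℕ.* y ℕ.+ 12 ℕ.* (z ℕ.* z) ≡ 12 ℕ.* (pentagonal y ℕ.+ pentagonal y ℕ.+ z ℕ.* z) ℕ.+ 1
    squares = ≡.trans (cong (ℕ._+ 12 ℕ.* (z ℕ.* z)) y²) (collect (pentagonal y) (z ℕ.* z))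
      where
      collect : ∀ a b → suc (a ℕ.* 24) ℕ.+ 12 ℕ.* b ≡ 12 ℕ.* (a ℕ.+ a ℕ.+ b) ℕ.+ 1
      collect = ℕSolver.solve-∀

-- Dilation by a prime in each residue class modulo 12

module _ {p : ℕ} (pp : Prime p) (q N M : ℕ) (N∼M : 12 ℕ.* N ℕ.+ 1 ≡ p ℕ.* p ℕ.* (12 ℕ.* M ℕ.+ 1)) where

  private
    instance
      p≢0 : ℕ.NonZero p
      p≢0 = prime⇒nonZero pp

    conclude : ∀ ε {c c′} → + σmex N ≋ c → + σmex M ≋ c′ → c ≡ ε ℤ.* c′ → + σmex N ≋ ε ℤ.* + σmex M
    conclude ε N≋ M≋ eq = ≋-trans N≋ (≋-trans (≋-reflexive eq) (≋-sym (≋-* (≋-reflexive {ε} refl) M≋)))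

  -- For p ≡ 7 both characters change sign and for p ≡ 11 neither does; in either case their product
  -- is preserved, so the two classes share this argument. Doubling the relation between N and M
  -- yields the right-hand sides 24N + 2 and 24M + 2 of the form.
  σmex-Gaussian : ∀ t → p ≡ 4 ℕ.* t ℕ.+ 3 → (∀ y z → χ (y ℕ.* p) ℤ.* χ (z ℕ.* p) ≡ + 1 ℤ.* (χ y ℤ.* χ z)) →
    + σmex N ≋ + 1 ℤ.* + σmex M
  σmex-Gaussian t p≡ dilate = conclude (+ 1) (σmex≋two-squares N) (σmex≋two-squares M)
    (TwoSquares.count-dilate p (+ 1) (24 ℕ.* N ℕ.+ 2) (24 ℕ.* M ℕ.+ 2) doubled
      (InertPrimes.inert-Gaussian pp t p≡) (homogeneous p) dilate (two-squares-bounded N) (two-squares-bounded M))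
    where
    double : ∀ N → 24 ℕ.* N ℕ.+ 2 ≡ 2 ℕ.* (12 ℕ.* N ℕ.+ 1)
    double = ℕSolver.solve-∀
    undouble : ∀ p M → 2 ℕ.* (p ℕ.* p ℕ.* (12 ℕ.* M ℕ.+ 1)) ≡ p ℕ.* p ℕ.* (24 ℕ.* M ℕ.+ 2)
    undouble = ℕSolver.solve-∀
    doubled : 24 ℕ.* N ℕ.+ 2 ≡ p ℕ.* p ℕ.* (24 ℕ.* M ℕ.+ 2)
    doubled = ≡.trans (double N) (≡.trans (cong (2 ℕ.*_) N∼M) (undouble p M))
    homogeneous : ∀ p y z → y ℕ.* p ℕ.* (y ℕ.* p) ℕ.+ z ℕ.* p ℕ.* (z ℕ.* p) ≡ p ℕ.* p ℕ.* (y ℕ.* y ℕ.+ z ℕ.* z)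
    homogeneous = ℕSolver.solve-∀

  σmex-5 : p ≡ 5 ℕ.+ q ℕ.* 12 → + σmex N ≋ -[1+ 0 ] ℤ.* + σmex M
  σmex-5 p≡ = conclude -[1+ 0 ] (σmex≋square+12square N) (σmex≋square+12square M)
    (Square+12Square.count-dilate p -[1+ 0 ] (12 ℕ.* N ℕ.+ 1) (12 ℕ.* M ℕ.+ 1) N∼M
      (InertPrimes.inert-Eisenstein pp (4 ℕ.* q ℕ.+ 1) (≡.trans p≡ (mod3 q)) (subst (4 ℕ.<_) (≡.sym p≡) (ℕ.m≤m+n 5 (q ℕ.* 12))))
      (homogeneous p) dilate (square+12square-bounded N) (square+12square-bounded M))
    where
    mod3 : ∀ q → 5 ℕ.+ q ℕ.* 12 ≡ 3 ℕ.* (4 ℕ.* q ℕ.+ 1) ℕ.+ 2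
    mod3 = ℕSolver.solve-∀
    mod2 : ∀ q → 5 ℕ.+ q ℕ.* 12 ≡ suc ((2 ℕ.+ q ℕ.* 6) ℕ.* 2)
    mod2 = ℕSolver.solve-∀
    homogeneous : ∀ p y z → y ℕ.* p ℕ.* (y ℕ.* p) ℕ.+ 12 ℕ.* (z ℕ.* p ℕ.* (z ℕ.* p)) ≡ p ℕ.* p ℕ.* (y ℕ.* y ℕ.+ 12 ℕ.* (z ℕ.* z))
    homogeneous = ℕSolver.solve-∀
    dilate : ∀ y z → χ (y ℕ.* p) ℤ.* squareWeight (z ℕ.* p) ≡ -[1+ 0 ] ℤ.* (χ y ℤ.* squareWeight z)
    dilate y z = ≡.trans (cong₂ ℤ._*_
      (≡.trans (cong (λ p → χ (y ℕ.* p)) p≡) (≡.trans (χ-*-mod q 5 y) (χ-*5 y)))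
      (≡.trans (cong (λ p → squareWeight (z ℕ.* p)) (≡.trans p≡ (mod2 q))) (squareWeight-odd (2 ℕ.+ q ℕ.* 6) z)))
      (negate (χ y) (squareWeight z))
      where
      negate : ∀ a b → ℤ.- a ℤ.* b ≡ -[1+ 0 ] ℤ.* (a ℤ.* b)
      negate = ℤSolver.solve-∀

  σmex-7 : p ≡ 7 ℕ.+ q ℕ.* 12 → + σmex N ≋ + 1 ℤ.* + σmex M
  σmex-7 p≡ = σmex-Gaussian (1 ℕ.+ 3 ℕ.* q) (≡.trans p≡ (mod4 q)) λ y z →
    ≡.trans (cong₂ ℤ._*_ (dilate y) (dilate z)) (negate (χ y) (χ z))
    where
    mod4 : ∀ q → 7 ℕ.+ q ℕ.* 12 ≡ 4 ℕ.* (1 ℕ.+ 3 ℕ.* q) ℕ.+ 3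
    mod4 = ℕSolver.solve-∀
    dilate : ∀ y → χ (y ℕ.* p) ≡ ℤ.- χ y
    dilate y = ≡.trans (cong (λ p → χ (y ℕ.* p)) p≡) (≡.trans (χ-*-mod q 7 y) (χ-*7 y))
    negate : ∀ a b → ℤ.- a ℤ.* ℤ.- b ≡ + 1 ℤ.* (a ℤ.* b)
    negate = ℤSolver.solve-∀

  σmex-11 : p ≡ 11 ℕ.+ q ℕ.* 12 → + σmex N ≋ + 1 ℤ.* + σmex M
  σmex-11 p≡ = σmex-Gaussian (2 ℕ.+ 3 ℕ.* q) (≡.trans p≡ (mod4 q)) λ y z →
    ≡.trans (cong₂ ℤ._*_ (dilate y) (dilate z)) (≡.sym (ℤ.*-identityˡ (χ y ℤ.* χ z)))
    where
    mod4 : ∀ q → 11 ℕ.+ q ℕ.* 12 ≡ 4 ℕ.* (2 ℕ.+ 3 ℕ.* q) ℕ.+ 3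
    mod4 = ℕSolver.solve-∀
    dilate : ∀ y → χ (y ℕ.* p) ≡ χ y
    dilate y = ≡.trans (cong (λ p → χ (y ℕ.* p)) p≡) (≡.trans (χ-*-mod q 11 y) (χ-*11 y))

  σmex-dilate : ∀ i → i ≡ 5 ⊎ i ≡ 7 ⊎ i ≡ 11 → p ≡ i ℕ.+ q ℕ.* 12 → + σmex N ≋ f p ℤ.* + σmex M
  -- The abstracted comparison is the one that `f` branches on, so `f p` reduces to its sign in
  -- every clause; the mismatched clauses contradict the residue of p.
  σmex-dilate i i∈ p≡ with p ℕ.% 12 ℕ.≟ 5 | i∈
  ... | yes _   | inj₁ refl = σmex-5 p≡
  ... | no ≢5   | inj₁ refl = ⊥-elim (≢5 (≡.trans (cong (ℕ._% 12) p≡) (ℕ.[m+kn]%n≡m%n 5 q 12)))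
  ... | no _    | inj₂ (inj₁ refl) = σmex-7 p≡
  ... | no _    | inj₂ (inj₂ refl) = σmex-11 p≡
  ... | yes ≡5  | inj₂ (inj₁ refl) with () ← ≡.trans (≡.sym ≡5) (≡.trans (cong (ℕ._% 12) p≡) (ℕ.[m+kn]%n≡m%n 7 q 12))
  ... | yes ≡5  | inj₂ (inj₂ refl) with () ← ≡.trans (≡.sym ≡5) (≡.trans (cong (ℕ._% 12) p≡) (ℕ.[m+kn]%n≡m%n 11 q 12))

open import Data.Nat using (ℕ; _+_; _*_; _∸_; _^_; _≤_; _%_; _/_)
open import Data.Nat.Properties using (m*n≢0)
open import Data.Nat.Divisibility using (_∣_)
open import Data.Nat.Primality using (Prime; prime⇒nonZero)
open import Data.Integer using (ℤ; +_; _-_) renaming (_*_ to _*ℤ_)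
open import Data.Integer.Divisibility renaming (_∣_ to _∣ℤ_)
open import Data.Sum using (_⊎_)
open import Relation.Binary.PropositionalEquality using (_≡_)

-- The arithmetic relating the two arguments of `σmex`

-- Every unit modulo 12 is its own inverse; the witnesses 2, 4, 10 are (i² - 1)/12.
i²≡1+12h : ∀ i → i ≡ 5 ⊎ i ≡ 7 ⊎ i ≡ 11 → i % 12 ≡ i × Σ ℕ λ h → i * i ≡ 1 + h * 12
i²≡1+12h i (inj₁ refl)        = refl , 2 , refl
i²≡1+12h i (inj₂ (inj₁ refl)) = refl , 4 , refl
i²≡1+12h i (inj₂ (inj₂ refl)) = refl , 10 , refl

-- c p ≡ i (mod 12) and p ≡ i give c ≡ c i² ≡ i² ≡ 1.
cofactor≡1 : ∀ {i h q p δ} c → i * i ≡ 1 + h * 12 → p ≡ i + q * 12 → 12 * δ + i ≡ c * p → c ≡ 1 + c / 12 * 12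
cofactor≡1 {i} {h} {q} {p} {δ} c i² p≡ eq = begin
  c                        ≡⟨ ℕ.m≡m%n+[m/n]*n c 12 ⟩
  c % 12 + c / 12 * 12     ≡⟨ cong (_+ c / 12 * 12) c%12≡1 ⟩
  1 + c / 12 * 12          ∎
  where
  open ≡.≡-Reasoning
  left : ∀ c h q i → c + (c * h + c * q * i) * 12 ≡ c * (1 + h * 12) + c * q * i * 12
  left = ℕSolver.solve-∀
  middle : ∀ c q i → c * (i * i) + c * q * i * 12 ≡ c * (i + q * 12) * i
  middle = ℕSolver.solve-∀
  right : ∀ δ i h → 12 * δ * i + (1 + h * 12) ≡ 1 + (δ * i + h) * 12
  right = ℕSolver.solve-∀
  -- The equation 12δ + i = c p is multiplied by i; the multiples of 12 coming from i² and from p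
  -- are added on the left instead of being subtracted on the right.
  multiplied : c + (c * h + c * q * i) * 12 ≡ 1 + (δ * i + h) * 12
  multiplied = begin
    c + (c * h + c * q * i) * 12           ≡⟨ left c h q i ⟩
    c * (1 + h * 12) + c * q * i * 12      ≡⟨ cong (λ w → c * w + c * q * i * 12) i² ⟨
    c * (i * i) + c * q * i * 12           ≡⟨ middle c q i ⟩
    c * (i + q * 12) * i                   ≡⟨ cong (λ w → c * w * i) p≡ ⟨
    c * p * i                              ≡⟨ cong (_* i) eq ⟨
    (12 * δ + i) * i                       ≡⟨ ℕ.*-distribʳ-+ i (12 * δ) i ⟩
    12 * δ * i + i * i                     ≡⟨ cong (λ w → 12 * δ * i + w) i² ⟩
    12 * δ * i + (1 + h * 12)              ≡⟨ right δ i h ⟩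
    1 + (δ * i + h) * 12                   ∎
  c%12≡1 : c % 12 ≡ 1
  c%12≡1 = begin
    c % 12                                 ≡⟨ ℕ.[m+kn]%n≡m%n c (c * h + c * q * i) 12 ⟨
    (c + (c * h + c * q * i) * 12) % 12    ≡⟨ cong (_% 12) multiplied ⟩
    (1 + (δ * i + h) * 12) % 12            ≡⟨ ℕ.[m+kn]%n≡m%n 1 (δ * i + h) 12 ⟩
    1                                      ∎

theorem1p2 : (k : ℕ) → 1 ≤ k → (i : ℕ) → (i ≡ 5 ⊎ i ≡ 7 ⊎ i ≡ 11) →
    (p : ℕ) → (pp : Prime p) → p % 12 ≡ i % 12 →
    (δ : ℕ) → p ∣ 12 * δ + i → (n : ℕ) →
    (+ 4) ∣ℤ ((+ σmex (p ^ (k + 1) * n + p * δ + (p * i ∸ 1) / 12))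
    - (f p *ℤ (+ σmex (p ^ (k ∸ 1) * n
    + _/_ (12 * δ + i ∸ p) (12 * p) {{m*n≢0 12 p {{_}} {{prime⇒nonZero pp}}}}))))
theorem1p2 (suc k) _ i i∈ p pp p%12 δ (ℕ.divides c eq) n =
  ℤ.∣⇒∣ᵤ (subst (λ w → (+ 4) ℤ.∣ (+ σmex N - (f p *ℤ (+ σmex (p ^ k * n + w))))) (≡.sym M₀≡)
    (Congruence._≋_.divisible (σmex-dilate pp q N M dilated i i∈ p≡)))
  where
  open ≡.≡-Reasoning
  h = proj₁ (proj₂ (i²≡1+12h i i∈))
  i² = proj₂ (proj₂ (i²≡1+12h i i∈))
  q = p / 12
  p≡ : p ≡ i + q * 12
  p≡ = ≡.trans (ℕ.m≡m%n+[m/n]*n p 12) (cong (_+ q * 12) (≡.trans p%12 (proj₁ (i²≡1+12h i i∈))))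
  M₀ = c / 12
  c≡ : c ≡ 1 + M₀ * 12
  c≡ = cofactor≡1 {i} {h} {q} {p} {δ} c i² p≡ eq
  h′ = (p * i ∸ 1) / 12
  N = p ^ (suc k + 1) * n + p * δ + h′
  M = p ^ k * n + M₀
  -- Since c = 1 + 12 M₀, one has 12δ + i = p + M₀ (12 p), so neither the truncated subtraction nor
  -- the division loses anything.
  M₀≡ : _/_ (12 * δ + i ∸ p) (12 * p) {{m*n≢0 12 p {{_}} {{prime⇒nonZero pp}}}} ≡ M₀
  M₀≡ = begin
    (12 * δ + i ∸ p) / (12 * p)      ≡⟨ cong (λ w → (w ∸ p) / (12 * p)) (≡.trans eq (cong (_* p) c≡)) ⟩
    (p + M₀ * 12 * p ∸ p) / (12 * p) ≡⟨ cong (_/ (12 * p)) (≡.trans (ℕ.m+n∸m≡n p (M₀ * 12 * p)) (ℕ.*-assoc M₀ 12 p)) ⟩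
    M₀ * (12 * p) / (12 * p)         ≡⟨ ℕ.m*n/n≡m M₀ (12 * p) ⟩
    M₀                               ∎
    where instance _ = m*n≢0 12 p {{_}} {{prime⇒nonZero pp}}
  -- p i ≡ i² ≡ 1 (mod 12), so (p i - 1)/12 is exact.
  pi≡ : p * i ≡ 1 + h′ * 12
  pi≡ = ≡.trans expand (cong (λ w → 1 + w * 12) (≡.sym (≡.trans (cong (λ w → (w ∸ 1) / 12) expand) (ℕ.m*n/n≡m (h + q * i) 12))))
    where
    rearrange : ∀ i q h → 1 + h * 12 + q * 12 * i ≡ 1 + (h + q * i) * 12
    rearrange = ℕSolver.solve-∀
    expand : p * i ≡ 1 + (h + q * i) * 12
    expand = begin
      p * i                         ≡⟨ cong (_* i) p≡ ⟩
      (i + q * 12) * i              ≡⟨ ℕ.*-distribʳ-+ i i (q * 12) ⟩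
      i * i + q * 12 * i            ≡⟨ cong (_+ q * 12 * i) i² ⟩
      1 + h * 12 + q * 12 * i       ≡⟨ rearrange i q h ⟩
      1 + (h + q * i) * 12          ∎
  -- The offsets are chosen for this: 12 p δ and p i combine to p (12δ + i) = c p², and c = 1 + 12
  -- M₀. After matching on `suc k` the powers of p are k + 2 and k, so the same p² splits off the
  -- term with n.
  dilated : 12 * N + 1 ≡ p * p * (12 * M + 1)
  dilated = begin
    12 * (p * p ^ (k + 1) * n + p * δ + h′) + 1
      ≡⟨ cong (λ w → 12 * (p * p ^ w * n + p * δ + h′) + 1) (ℕ.+-comm k 1) ⟩
    12 * (p * (p * p ^ k) * n + p * δ + h′) + 1
      ≡⟨ split p (p ^ k) n δ h′ ⟩
    p * p * (12 * (p ^ k * n)) + p * (12 * δ) + (1 + h′ * 12)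
      ≡⟨ cong (λ w → p * p * (12 * (p ^ k * n)) + p * (12 * δ) + w) pi≡ ⟨
    p * p * (12 * (p ^ k * n)) + p * (12 * δ) + p * i
      ≡⟨ factor p (p ^ k * n) (12 * δ) i ⟩
    p * p * (12 * (p ^ k * n)) + p * (12 * δ + i)
      ≡⟨ cong (λ w → p * p * (12 * (p ^ k * n)) + p * w) (≡.trans eq (cong (_* p) c≡)) ⟩
    p * p * (12 * (p ^ k * n)) + p * ((1 + M₀ * 12) * p)
      ≡⟨ collect p (p ^ k * n) M₀ ⟩
    p * p * (12 * M + 1) ∎
    where
    split : ∀ p P n δ h → 12 * (p * (p * P) * n + p * δ + h) + 1 ≡ p * p * (12 * (P * n)) + p * (12 * δ) + (1 + h * 12)
    split = ℕSolver.solve-∀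
    factor : ∀ p a b i → p * p * (12 * a) + p * b + p * i ≡ p * p * (12 * a) + p * (b + i)
    factor = ℕSolver.solve-∀
    collect : ∀ p a m → p * p * (12 * a) + p * ((1 + m * 12) * p) ≡ p * p * (12 * (a + m) + 1)
    collect = ℕSolver.solve-∀
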